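{- Let $k\geq 2$ and $s\geq 1$ be integers and let $\alpha\in[\frac{ks+1}{ks+s},1]$ be rational. Let $\ell$ be the smallest positive integer such that $\frac{\ell}{(2k+1)s}$ and $\frac{\alpha\ell}{(2k+1)s}$ are integers. There exist integers $t_0,q_0$ such that for every integer $t\geq t_0$ and every prime power $q\geq q_0$ there exists a bipartite graph $G$ with parts $M,N$, $|M|=q^{\alpha\ell}$, $|N|=q^{\ell}$, such that $G$ is $K_{s,t}^{(2k+1)}$-free and \[e(G)\geq \frac12 |M|^{1-\frac{k}{2k+1}}|N|^{1-\frac{k}{2k+1}-\frac{1}{(2k+1)s}}.\]
   Context: For a graph $H$ and a positive integer $k$, $H^{(k)}$ is obtained from $H$ by replacing each edge $uv$ by a path of length $k$ from $u$ to $v$, these paths being pairwise internally vertex-disjoint. $K_{s,t}$ is the complete bipartite graph with parts of sizes $s$ and $t$. -}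

module Defs where

open import Data.Nat using (ℕ; zero; suc; _+_; _*_; _^_; _≤_; _<_; _<?_)
open import Data.Nat.Primality using (Prime)
open import Data.Fin using (Fin; zero; suc; toℕ; fromℕ<)
open import Data.Sum using (_⊎_; inj₁; inj₂)
open import Data.Product using (_×_; _,_; Σ; ∃-syntax)
open import Data.Bool using (Bool; true; false; T)
open import Data.Empty using (⊥)
open import Data.Integer using (ℤ)
open import Data.Rational using (ℚ; _/_)
open import Relation.Nullary using (¬_; yes; no)
open import Relation.Binary.PropositionalEquality using (_≡_)
open import Function.Definitions using (Injective)

IsPrimePower : ℕ → Set
IsPrimePower q = ∃[ p ] ∃[ r ] (Prime p × 1 ≤ r × q ≡ p ^ r)

IsInt : ℚ → Set
IsInt x = ∃[ z ] (x ≡ z / 1)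

BipGraph : ℕ → ℕ → Set
BipGraph m n = Fin m → Fin n → Bool

Vtx : ℕ → ℕ → Set
Vtx m n = Fin m ⊎ Fin n

Adj : ∀ {m n} → BipGraph m n → Vtx m n → Vtx m n → Set
Adj G (inj₁ i) (inj₂ j) = T (G i j)
Adj G (inj₂ j) (inj₁ i) = T (G i j)
Adj G (inj₁ _) (inj₁ _) = ⊥
Adj G (inj₂ _) (inj₂ _) = ⊥

countB : ∀ {n} → (Fin n → Bool) → ℕ
countB {zero} f = 0
countB {suc n} f = if' (f zero) + countB (λ i → f (suc i))
  where
  if' : Bool → ℕ
  if' true = 1
  if' false = 0

sumFin : ∀ {n} → (Fin n → ℕ) → ℕ
sumFin {zero} f = 0
sumFin {suc n} f = f zero + sumFin (λ i → f (suc i))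

edges : ∀ {m n} → BipGraph m n → ℕ
edges G = sumFin (λ i → countB (G i))

-- Vertices of K_{s,t}^{(suc d)}: branch vertices a_i (i < s), b_j (j < t),
-- and d internal vertices on the path replacing each edge a_i b_j.
data SubdivV (s t d : ℕ) : Set where
  branchA  : Fin s → SubdivV s t d
  branchB  : Fin t → SubdivV s t d
  internal : Fin s → Fin t → Fin d → SubdivV s t d

-- the r-th vertex (r = 0 .. d+1) of the path of length d+1 from a_i to b_j
pathV : ∀ {s t d} → Fin s → Fin t → Fin (suc (suc d)) → SubdivV s t d
pathV i j zero = branchA i
pathV {d = d} i j (suc r) with toℕ r <? d
... | yes p = internal i j (fromℕ< p)
... | no _  = branchB j

SubdivEdge : ∀ {s t d} → SubdivV s t d → SubdivV s t d → Set
SubdivEdge {s} {t} {d} u v =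
  Σ (Fin s) λ i → Σ (Fin t) λ j → Σ (Fin (suc d)) λ r →
    (pathV i j (Data.Fin.inject₁ r) ≡ u) × (pathV i j (suc r) ≡ v)

ContainsSubdivKst : ∀ {m n} → ℕ → ℕ → ℕ → BipGraph m n → Set
ContainsSubdivKst {m} {n} s t d G =
  Σ (SubdivV s t d → Vtx m n) λ φ →
    Injective _≡_ _≡_ φ ×
    (∀ u v → SubdivEdge u v → Adj G (φ u) (φ v))

KstSubdivFree : ∀ {m n} → ℕ → ℕ → ℕ → BipGraph m n → Set
KstSubdivFree s t d G = ¬ ContainsSubdivKst s t d G

ℕ→ℚ : ℕ → ℚ
ℕ→ℚ n = Data.Integer.+_ n / 1

-- x / d is an integer (for d ≠ 0): x = z · d for some integer z
IsIntQuot : ℚ → ℕ → Set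
IsIntQuot x d = ∃[ z ] (x ≡ (z / 1) Data.Rational.* ℕ→ℚ d)

EllCond : ℕ → ℕ → ℚ → ℕ → Set
EllCond k s α ℓ =
  IsIntQuot (ℕ→ℚ ℓ) (suc (2 * k) * s) ×
  IsIntQuot (α Data.Rational.* ℕ→ℚ ℓ) (suc (2 * k) * s)

IsLeastEll : ℕ → ℕ → ℚ → ℕ → Set
IsLeastEll k s α ℓ =
  1 ≤ ℓ × EllCond k s α ℓ × (∀ ℓ' → 1 ≤ ℓ' → EllCond k s α ℓ' → ℓ ≤ ℓ')

{-# OPTIONS --safe #-}

-- Write a vertex of N as y = (y′ , u) with y′ consisting of c coordinates, and join x to y
-- iff y′ = f(x , u), where f is a polynomial map modulo a prime p ∈ [q , 64q], reduced
-- modulo q. The number of edges is then exact, and c is such that the s paths leading to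
-- one vertex bⱼ have at most as many unknowns as equations.
--
-- Suppose that for every choice of the n coefficients of f in {0,…,D} there are roots A with
-- many disjoint solutions bⱼ. Consider the points (f , A , W₁ , … , Wᵣ) with Wᵢ ranging over
-- D + 1 of these solutions: there are (D+1)^(n+r) of them, and each has an indicator
-- polynomial of degree O(D). On the other hand the equations express as many coefficients
-- of f as there are unknowns in W₁ , … , Wᵣ rationally through the remaining data, so that,
-- on each of boundedly many charts, all these functions are polynomials of degree O(D) in
-- only n + dim A coordinates. For r > dim A and D large this is a contradiction. The
-- bounds do not depend on q, and this argument takes the place of the Lang–Weil bound.

module Submission where

open import Data.Nat as ℕ using (ℕ; zero; suc; z≤n; s≤s)
import Data.Nat.Properties as ℕ
import Data.Nat.Tactic.RingSolver as ℕ
open import Data.Fin as Fin using (Fin; zero; suc; toℕ; fromℕ<; combine; remQuot; finToFun; funToFin; punchIn; punchOut; splitAt; _↑ˡ_; _↑ʳ_; inject₁; inject≤)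
import Data.Fin.Properties as Fin
open import Data.Empty using (⊥; ⊥-elim)
open import Data.Product using (_×_; _,_; ∃-syntax; proj₁; proj₂; Σ)
open import Data.Sum using (_⊎_; inj₁; inj₂; [_,_]′)
open import Data.Unit using (⊤; tt)
open import Function using (_∘_; id; _↔_; Inverse)
open import Function.Definitions using (Injective)
open import Relation.Nullary using (¬_; Dec; yes; no; contradiction)
open import Relation.Nullary.Decidable using (¬?; _×-dec_; _→-dec_; map′; ⌊_⌋; toWitness; fromWitness)
open import Relation.Unary using (Decidable)
open import Relation.Binary.PropositionalEquality

-- Primes between q and 64q

-- The parts need exactly q^a and q^ℓ vertices, so vertices are strings of digits below q, while
-- solving for coefficients needs a field: hence the two moduli. Reduction modulo q forgets the
-- quotient of a residue by q. As p ≤ 64q, it takes at most 64 values, and fixing these quotients on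
-- a chart restores congruences modulo p.
--
-- Coefficients are solved for by interpolation in one variable, which needs distinct nodes, but the
-- points (x , u) of the r chosen solutions are distinct only as vectors. A projection fixed in
-- advance may fail to separate them, since the solutions vary with f. Therefore f is a sum of
-- univariate polynomials in T linear projections, with T so large that any R = r·m distinct points
-- are separated by one of them. Its R coefficients in each of the c components are the ones
-- eliminated, and which projection it is becomes part of the chart.

module Primes where

  open import Data.Nat
  open import Data.Nat.Combinatorics hiding (_P_)
  open import Data.Nat.Divisibility
  open import Data.Nat.DivMod using (m/n*n≡m)
  open import Data.Nat.GCD using (gcd)
  open import Data.Nat.Induction using (<-wellFounded)
  open import Data.Nat.LCM
  open import Data.Nat.Primality
  open import Data.Nat.Primality.Factorisation using (factorise)
  open import Data.Nat.Properties
  open import Data.Nat.Tactic.RingSolver using (solve-∀)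
  open import Data.List using ([]; _∷_)
  open import Data.List.Relation.Unary.All using (_∷_)
  open import Induction.WellFounded using (Acc; acc)

  -- Binomial coefficients

  nC0≡1 : ∀ n → n C 0 ≡ 1
  nC0≡1 n = trans (nCk≡nC[n∸k] (z≤n {n})) (nCn≡1 n)

  [1+k]*[1+n]C[1+k]≡[1+n]*nCk : ∀ n k → suc k * (suc n C suc k) ≡ suc n * (n C k)
  [1+k]*[1+n]C[1+k]≡[1+n]*nCk zero zero = refl
  [1+k]*[1+n]C[1+k]≡[1+n]*nCk zero (suc k)
    rewrite k>n⇒nCk≡0 {1} {2 + k} (s≤s (s≤s z≤n)) | k>n⇒nCk≡0 {0} {suc k} (s≤s z≤n) = *-zeroʳ k
  [1+k]*[1+n]C[1+k]≡[1+n]*nCk (suc n) zero = begin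
    1 * (suc (suc n) C 1)        ≡⟨ *-identityˡ _ ⟩
    suc (suc n) C 1              ≡⟨ nC1≡n (suc (suc n)) ⟩
    suc (suc n)                  ≡⟨ *-identityʳ _ ⟨
    suc (suc n) * 1              ≡⟨ cong (suc (suc n) *_) (nC0≡1 (suc n)) ⟨
    suc (suc n) * (suc n C 0)    ∎
    where open ≡-Reasoning
  [1+k]*[1+n]C[1+k]≡[1+n]*nCk (suc n) (suc k) = begin
    suc (suc k) * (suc (suc n) C suc (suc k))
      ≡⟨ cong (suc (suc k) *_) (nCk+nC[k+1]≡[n+1]C[k+1] (suc n) (suc k)) ⟨
    suc (suc k) * (y + (suc n C suc (suc k)))
      ≡⟨ *-distribˡ-+ (suc (suc k)) y _ ⟩
    (y + suc k * y) + suc (suc k) * (suc n C suc (suc k))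
      ≡⟨ cong₂ (λ u v → (y + u) + v) ([1+k]*[1+n]C[1+k]≡[1+n]*nCk n k) ([1+k]*[1+n]C[1+k]≡[1+n]*nCk n (suc k)) ⟩
    (y + suc n * (n C k)) + suc n * (n C suc k)
      ≡⟨ +-assoc y _ _ ⟩
    y + (suc n * (n C k) + suc n * (n C suc k))
      ≡⟨ cong (y +_) (*-distribˡ-+ (suc n) (n C k) _) ⟨
    y + suc n * (n C k + n C suc k)
      ≡⟨ cong (λ u → y + suc n * u) (nCk+nC[k+1]≡[n+1]C[k+1] n k) ⟩
    y + suc n * y ∎
    where
    open ≡-Reasoning
    y = suc n C suc k

  nCk≤[1+n]C[1+k] : ∀ n k → n C k ≤ suc n C suc k
  nCk≤[1+n]C[1+k] n k = subst (n C k ≤_) (nCk+nC[k+1]≡[n+1]C[k+1] n k) (m≤m+n _ _)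

  nCk≤[1+n]Ck : ∀ n k → n C k ≤ suc n C k
  nCk≤[1+n]Ck n zero = ≤-reflexive (trans (nC0≡1 n) (sym (nC0≡1 (suc n))))
  nCk≤[1+n]Ck n (suc k) = subst (n C suc k ≤_) (nCk+nC[k+1]≡[n+1]C[k+1] n k) (m≤n+m _ _)

  nCk≤2^n : ∀ n k → n C k ≤ 2 ^ n
  nCk≤2^n zero zero = ≤-refl
  nCk≤2^n zero (suc k) = subst (_≤ 1) (sym (k>n⇒nCk≡0 {0} {suc k} (s≤s z≤n))) z≤n
  nCk≤2^n (suc n) zero = subst (_≤ 2 ^ suc n) (sym (nC0≡1 (suc n))) (m^n>0 2 (suc n))
  nCk≤2^n (suc n) (suc k) = begin
    suc n C suc k          ≡⟨ nCk+nC[k+1]≡[n+1]C[k+1] n k ⟨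
    n C k + n C suc k      ≤⟨ +-mono-≤ (nCk≤2^n n k) (nCk≤2^n n (suc k)) ⟩
    2 ^ n + 2 ^ n          ≡⟨ cong (2 ^ n +_) (+-identityʳ (2 ^ n)) ⟨
    2 ^ suc n              ∎
    where open ≤-Reasoning

  -- Both summands of the last Pascal step dominate the preceding central coefficient, so every step
  -- at least doubles.
  2^m≤[m+m]Cm : ∀ m → 2 ^ m ≤ (m + m) C m
  2^m≤[m+m]Cm zero = ≤-refl
  2^m≤[m+m]Cm (suc m) rewrite +-suc m m = begin
    2 ^ m + (2 ^ m + 0)                         ≡⟨ cong (2 ^ m +_) (+-identityʳ (2 ^ m)) ⟩
    2 ^ m + 2 ^ m                               ≤⟨ +-mono-≤ (2^m≤[m+m]Cm m) (2^m≤[m+m]Cm m) ⟩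
    x + x                                       ≤⟨ +-mono-≤ (nCk≤[1+n]Ck (m + m) m) (nCk≤[1+n]C[1+k] (m + m) m) ⟩
    (suc (m + m) C m) + (suc (m + m) C suc m)   ≡⟨ nCk+nC[k+1]≡[n+1]C[k+1] (suc (m + m)) m ⟩
    suc (suc (m + m)) C suc m                   ∎
    where
    open ≤-Reasoning
    x = (m + m) C m

  -- The least common multiple of 1, ..., n

  lcmUpTo : ℕ → ℕ
  lcmUpTo zero = 1
  lcmUpTo (suc n) = lcm (suc n) (lcmUpTo n)

  lcmUpTo≢0 : ∀ n → NonZero (lcmUpTo n)
  lcmUpTo≢0 zero = _
  lcmUpTo≢0 (suc n) = ≢-nonZero λ eq →
    ≢-nonZero⁻¹ (suc n * lcmUpTo n) {{m*n≢0 (suc n) (lcmUpTo n) {{_}} {{lcmUpTo≢0 n}}}}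
      (trans (sym (gcd*lcm (suc n) (lcmUpTo n))) (trans (cong (gcd (suc n) (lcmUpTo n) *_) eq) (*-zeroʳ (gcd (suc n) (lcmUpTo n)))))

  -- Leibniz's harmonic triangle: 1/a - 1/b = 1/c for the entries
  -- a = (1+n)·nCk, b = (2+n)·(1+n)Ck and c = (2+n)·(1+n)C(1+k),
  -- so c divides every common multiple of a and b.
  leibniz : ∀ n k → k ≤ n → suc n * (n C k) ∣ lcmUpTo (suc n)
  leibniz n zero _ rewrite nC0≡1 n | *-identityʳ n = m∣lcm[m,n] (suc n) (lcmUpTo n)
  leibniz (suc n) (suc k) (s≤s k≤n) = divides (X ∸ Y) (*-cancelˡ-≡ L _ (suc k) eq)
    where
    L = lcmUpTo (suc (suc n))
    y = suc n C k
    z = suc n C suc k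
    a = suc n * (n C k)
    b = suc (suc n) * y
    c = suc (suc n) * z
    a∣L : a ∣ L
    a∣L = ∣-trans (leibniz n k k≤n) (n∣lcm[m,n] (suc (suc n)) (lcmUpTo (suc n)))
    b∣L : b ∣ L
    b∣L = leibniz (suc n) k (m≤n⇒m≤1+n k≤n)
    X = quotient a∣L
    Y = quotient b∣L
    a≡ : suc k * z ≡ a
    a≡ = [1+k]*[1+n]C[1+k]≡[1+n]*nCk n k
    b≡ : suc k * y + suc k * z ≡ b
    b≡ = trans (sym (*-distribˡ-+ (suc k) y z))
        (trans (cong (suc k *_) (nCk+nC[k+1]≡[n+1]C[k+1] (suc n) k)) ([1+k]*[1+n]C[1+k]≡[1+n]*nCk (suc n) k))
    open ≡-Reasoning
    r1 : ∀ x k z n → x * (n * z) * k ≡ n * (x * (k * z))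
    r1 = solve-∀
    r3 : ∀ k y z n Y → n * (Y * (k * y + k * z)) ≡ k * (Y * (n * y)) + Y * (n * z) * k
    r3 = solve-∀
    eqX : X * c * suc k ≡ suc (suc n) * L
    eqX = begin
      X * c * suc k ≡⟨ r1 X (suc k) z (suc (suc n)) ⟩
      suc (suc n) * (X * (suc k * z)) ≡⟨ cong (λ u → suc (suc n) * (X * u)) a≡ ⟩
      suc (suc n) * (X * a) ≡⟨ cong (suc (suc n) *_) (_∣_.equality a∣L) ⟨
      suc (suc n) * L ∎
    eqY : suc (suc n) * L ≡ suc k * L + Y * c * suc k
    eqY = begin
      suc (suc n) * L ≡⟨ cong (suc (suc n) *_) (_∣_.equality b∣L) ⟩
      suc (suc n) * (Y * b) ≡⟨ cong (λ u → suc (suc n) * (Y * u)) b≡ ⟨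
      suc (suc n) * (Y * (suc k * y + suc k * z)) ≡⟨ r3 (suc k) y z (suc (suc n)) Y ⟩
      suc k * (Y * b) + Y * c * suc k ≡⟨ cong (λ u → suc k * u + Y * c * suc k) (_∣_.equality b∣L) ⟨
      suc k * L + Y * c * suc k ∎
    eq : suc k * L ≡ suc k * ((X ∸ Y) * c)
    eq = begin
      suc k * L ≡⟨ m+n∸n≡m (suc k * L) (Y * c * suc k) ⟨
      (suc k * L + Y * c * suc k) ∸ Y * c * suc k ≡⟨ cong (_∸ Y * c * suc k) (trans eqX eqY) ⟨
      X * c * suc k ∸ Y * c * suc k ≡⟨ *-distribʳ-∸ (suc k) (X * c) (Y * c) ⟨
      (X * c ∸ Y * c) * suc k ≡⟨ cong (_* suc k) (*-distribʳ-∸ c X Y) ⟨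
      (X ∸ Y) * c * suc k ≡⟨ *-comm _ (suc k) ⟩
      suc k * ((X ∸ Y) * c) ∎

  -- By absorption, (m+1)·C(2m+2, m+1) = (2m+2)·C(2m+1, m), which is an entry of Leibniz's triangle
  -- and so divides the lcm.
  2^m≤lcmUpTo : ∀ m → 2 ^ m ≤ lcmUpTo (m + m)
  2^m≤lcmUpTo zero = ≤-refl
  2^m≤lcmUpTo (suc m) = ≤-trans (2^m≤[m+m]Cm (suc m)) (∣⇒≤ {{lcmUpTo≢0 (suc m + suc m)}} dvd)
    where
    dvd : (suc m + suc m) C suc m ∣ lcmUpTo (suc m + suc m)
    dvd = ∣-trans (divides (suc m) (sym ([1+k]*[1+n]C[1+k]≡[1+n]*nCk (m + suc m) m)))
                  (leibniz (m + suc m) m (m≤m+n m (suc m)))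

  factor-out : ∀ p → 2 ≤ p → ∀ n → 1 ≤ n → ∃[ v ] ∃[ m ] (n ≡ p ^ v * m × ¬ p ∣ m)
  factor-out p 2≤p n 1≤n = go n 1≤n (<-wellFounded n)
    where
    go : ∀ n → 1 ≤ n → Acc _<_ n → ∃[ v ] ∃[ m ] (n ≡ p ^ v * m × ¬ p ∣ m)
    go n 1≤n (acc rs) with p ∣? n
    ... | no p∤n = 0 , n , sym (+-identityʳ n) , p∤n
    ... | yes (divides zero refl) = contradiction 1≤n λ ()
    ... | yes (divides m@(suc _) refl) with go m (s≤s z≤n) (rs (m<m*n m p 2≤p))
    ...   | v , m′ , eq , p∤m′ = suc v , m′ , trans (cong (_* p) eq) (lem (p ^ v) m′ p) , p∤m′
      where
      lem : ∀ x y z → x * y * z ≡ z * x * y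
      lem = solve-∀

  prime⇒2≤ : ∀ {p} → Prime p → 2 ≤ p
  prime⇒2≤ {p} pr = nonTrivial⇒n>1 p {{prime⇒nonTrivial pr}}

  prime⇒1≤ : ∀ {p} → Prime p → 1 ≤ p
  prime⇒1≤ pr = ≤-trans (s≤s z≤n) (prime⇒2≤ pr)

  ^-monoʳ-∣ : ∀ p {i v} → i ≤ v → p ^ i ∣ p ^ v
  ^-monoʳ-∣ p {i} {v} i≤v = subst (p ^ i ∣_)
    (trans (sym (^-distribˡ-+-* p i (v ∸ i))) (cong (p ^_) (m+[n∸m]≡n i≤v))) (m∣m*n (p ^ (v ∸ i)))

  -- If p^(v+1) divides neither number, write them as p^i·a′ and p^j·b′ with i, j ≤ v and a′, b′
  -- prime to p. Both divide p^v·(a′b′), hence so does the lcm, and p would divide a′b′.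
  primePower∣lcm : ∀ {p} → Prime p → ∀ v a b → 1 ≤ a → 1 ≤ b → p ^ v ∣ lcm a b → p ^ v ∣ a ⊎ p ^ v ∣ b
  primePower∣lcm pr zero a b _ _ _ = inj₁ (1∣ a)
  primePower∣lcm {p} pr (suc v) a b 1≤a 1≤b d
    with p ^ suc v ∣? a | p ^ suc v ∣? b
       | factor-out p (prime⇒2≤ pr) a 1≤a | factor-out p (prime⇒2≤ pr) b 1≤b
  ... | yes x | _ | _ | _ = inj₁ x
  ... | no _ | yes x | _ | _ = inj₂ x
  ... | no p∤a | no p∤b | i , a′ , refl , p∤a′ | j , b′ , refl , p∤b′ = ⊥-elim contra
    where
    le : ∀ i m → ¬ p ^ suc v ∣ p ^ i * m → i ≤ v
    le i m h with i ≤? v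
    ... | yes q = q
    ... | no q = contradiction (∣m⇒∣m*n m (^-monoʳ-∣ p (≰⇒> q))) h
    a∣ : p ^ i * a′ ∣ p ^ v * (a′ * b′)
    a∣ = *-pres-∣ (^-monoʳ-∣ p (le i a′ p∤a)) (m∣m*n b′)
    b∣ : p ^ j * b′ ∣ p ^ v * (a′ * b′)
    b∣ = *-pres-∣ (^-monoʳ-∣ p (le j b′ p∤b)) (n∣m*n a′)
    p∣a′b′ : p ∣ a′ * b′
    p∣a′b′ = *-cancelˡ-∣ (p ^ v) {{m^n≢0 p v {{prime⇒nonZero pr}}}}
              (subst (_∣ p ^ v * (a′ * b′)) (*-comm p (p ^ v)) (∣-trans d (lcm-least a∣ b∣)))
    contra : ⊥
    contra with euclidsLemma a′ b′ pr p∣a′b′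
    ... | inj₁ x = p∤a′ x
    ... | inj₂ x = p∤b′ x

  primePower∣lcmUpTo⇒≤ : ∀ {p} → Prime p → ∀ v n → 1 ≤ n → p ^ v ∣ lcmUpTo n → p ^ v ≤ n
  primePower∣lcmUpTo⇒≤ {p} pr v (suc n) _ = go n
    where
    go : ∀ n → p ^ v ∣ lcmUpTo (suc n) → p ^ v ≤ suc n
    go zero d = ∣⇒≤ d
    go (suc n) d with primePower∣lcm pr v (suc (suc n)) (lcmUpTo (suc n)) (s≤s z≤n) (>-nonZero⁻¹ _ {{lcmUpTo≢0 (suc n)}}) d
    ... | inj₁ x = ∣⇒≤ x
    ... | inj₂ x = m≤n⇒m≤1+n (go n x)

  -- Chebyshev's bound for products of primes

  primeOr1 : ℕ → ℕ
  primeOr1 n with prime? n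
  ... | yes _ = n
  ... | no _ = 1

  1≤primeOr1 : ∀ n → 1 ≤ primeOr1 n
  1≤primeOr1 n with prime? n
  ... | yes pr = prime⇒1≤ pr
  ... | no _ = ≤-refl

  -- The product of the primes in the interval (m , m + j].
  primeProduct : ℕ → ℕ → ℕ
  primeProduct m zero = 1
  primeProduct m (suc j) = primeOr1 (m + suc j) * primeProduct m j

  1≤primeProduct : ∀ m j → 1 ≤ primeProduct m j
  1≤primeProduct m zero = ≤-refl
  1≤primeProduct m (suc j) = *-mono-≤ (1≤primeOr1 (m + suc j)) (1≤primeProduct m j)

  primeProduct-+ : ∀ m i j → primeProduct m (i + j) ≡ primeProduct m i * primeProduct (m + i) j
  primeProduct-+ m i zero rewrite +-identityʳ i = sym (*-identityʳ _)
  primeProduct-+ m i (suc j) rewrite +-suc i j | primeProduct-+ m i j | +-assoc m i (suc j) | +-suc i j =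
    lem (primeOr1 (m + suc (i + j))) (primeProduct m i) (primeProduct (m + i) j)
    where
    lem : ∀ x y z → x * (y * z) ≡ y * (x * z)
    lem = solve-∀

  prime∣primeProduct⇒≤ : ∀ {p} → Prime p → ∀ m j → p ∣ primeProduct m j → p ≤ m + j
  prime∣primeProduct⇒≤ pr m zero d = ⊥-elim (<⇒≱ (prime⇒2≤ pr) (∣⇒≤ d))
  prime∣primeProduct⇒≤ {p} pr m (suc j) d with euclidsLemma (primeOr1 (m + suc j)) (primeProduct m j) pr d
  ... | inj₂ x = ≤-trans (prime∣primeProduct⇒≤ pr m j x) (+-monoʳ-≤ m (n≤1+n j))
  ... | inj₁ x with prime? (m + suc j)
  ...   | yes pr′ = ∣⇒≤ {{prime⇒nonZero pr′}} x
  ...   | no _ = ⊥-elim (<⇒≱ (prime⇒2≤ pr) (∣⇒≤ x))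

  prime∣!⇒≤ : ∀ {p} → Prime p → ∀ n → p ∣ n ! → p ≤ n
  prime∣!⇒≤ pr zero d = ⊥-elim (<⇒≱ (prime⇒2≤ pr) (∣⇒≤ d))
  prime∣!⇒≤ pr (suc n) d with euclidsLemma (suc n) (n !) pr d
  ... | inj₁ x = ∣⇒≤ x
  ... | inj₂ x = m≤n⇒m≤1+n (prime∣!⇒≤ pr n x)

  n∣m! : ∀ {n m} → 1 ≤ n → n ≤ m → n ∣ m !
  n∣m! {suc n} _ n≤m = ∣-trans (m∣m*n (n !)) (m≤n⇒m!∣n! n≤m)

  [m+m]!≡ : ∀ m → (m + m) ! ≡ ((m + m) C m) * (m ! * m !)
  [m+m]!≡ m = begin
    (m + m) !  ≡⟨ m/n*n≡m (k![n∸k]!∣n! m≤) ⟨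
    ((m + m) ! / (m ! * (m + m ∸ m) !)) * (m ! * (m + m ∸ m) !) ≡⟨ cong (_* (m ! * (m + m ∸ m) !)) (nCk≡n!/k![n-k]! m≤) ⟨
    ((m + m) C m) * (m ! * (m + m ∸ m) !) ≡⟨ cong (λ u → ((m + m) C m) * (m ! * u !)) (m+n∸n≡m m m) ⟩
    ((m + m) C m) * (m ! * m !) ∎
    where
    open ≡-Reasoning
    m≤ = m≤m+n m m
    instance _ = m !* (m + m ∸ m) !≢0

  prime∣central : ∀ {p} → Prime p → ∀ m → m < p → p ≤ m + m → p ∣ (m + m) C m
  prime∣central {p} pr m m<p p≤2m
    with euclidsLemma ((m + m) C m) (m ! * m !) pr (subst (p ∣_) ([m+m]!≡ m) (n∣m! (prime⇒1≤ pr) p≤2m))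
  ... | inj₁ x = x
  ... | inj₂ x with euclidsLemma (m !) (m !) pr x
  ...   | inj₁ y = contradiction (prime∣!⇒≤ pr m y) (<⇒≱ m<p)
  ...   | inj₂ y = contradiction (prime∣!⇒≤ pr m y) (<⇒≱ m<p)

  -- Each new prime exceeds all those already in the product, so Euclid's lemma finds it in the
  -- cofactor.
  primeProduct∣central : ∀ m j → j ≤ m → primeProduct m j ∣ (m + m) C m
  primeProduct∣central m zero _ = 1∣ _
  primeProduct∣central m (suc j) j<m with prime? (m + suc j) | primeProduct∣central m j (<⇒≤ j<m)
  ... | no _ | ih = subst (_∣ (m + m) C m) (sym (*-identityˡ _)) ih
  ... | yes pr | ih@(divides X eq)
    with euclidsLemma X (primeProduct m j) pr
           (subst (m + suc j ∣_) eq (prime∣central pr m (m<m+n m (s≤s z≤n)) (+-monoʳ-≤ m j<m)))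
  ...   | inj₂ x = contradiction (prime∣primeProduct⇒≤ pr m j x) (<⇒≱ (+-monoʳ-< m (n<1+n j)))
  ...   | inj₁ x = subst ((m + suc j) * primeProduct m j ∣_) (sym eq) (*-monoˡ-∣ (primeProduct m j) x)

  -- Doubling argument: the primes in (m, 2m] multiply to a divisor of C(2m, m), which is at most
  -- 4^m.
  primeProduct-2^ : ∀ j → primeProduct 0 (2 ^ j) ≤ 2 ^ (2 * 2 ^ j)
  primeProduct-2^ zero = s≤s z≤n
  primeProduct-2^ (suc j) = begin
    primeProduct 0 (m + (m + 0))       ≡⟨ cong (λ u → primeProduct 0 (m + u)) (+-identityʳ m) ⟩
    primeProduct 0 (m + m)             ≡⟨ primeProduct-+ 0 m m ⟩
    primeProduct 0 m * primeProduct m m ≤⟨ *-mono-≤ (primeProduct-2^ j) (≤-trans (∣⇒≤ {{>-nonZero pos}} (primeProduct∣central m m ≤-refl)) (nCk≤2^n (m + m) m)) ⟩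
    2 ^ (2 * m) * 2 ^ (m + m)          ≡⟨ ^-distribˡ-+-* 2 (2 * m) (m + m) ⟨
    2 ^ (2 * m + (m + m))              ≡⟨ cong (2 ^_) (lem m) ⟩
    2 ^ (2 * (2 * m))                  ∎
    where
    open ≤-Reasoning
    m = 2 ^ j
    pos : 1 ≤ (m + m) C m
    pos = ≤-trans (m^n>0 2 m) (2^m≤[m+m]Cm m)
    lem : ∀ m → 2 * m + (m + m) ≡ 2 * (2 * m)
    lem = solve-∀

  noPrimeDivisor⇒≡1 : ∀ n → 1 ≤ n → (∀ {p} → Prime p → ¬ p ∣ n) → n ≡ 1
  noPrimeDivisor⇒≡1 n 1≤n none with factorise n {{>-nonZero 1≤n}}
  ... | record { factors = [] ; isFactorisation = eq } = eq
  ... | record { factors = p ∷ ps ; isFactorisation = eq ; factorsPrime = pr ∷ _ } =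
    contradiction (subst (p ∣_) (sym eq) (m∣m*n _)) (none pr)

  -- Split off the prime powers of B one prime at a time: a prime p ≤ S contributes at
  -- most M, and a larger one contributes at most p because p² > M.
  module Smooth (B M S n : ℕ) (1≤B : 1 ≤ B) (M≤S² : M ≤ S * S) (1≤M : 1 ≤ M)
    (pp : ∀ {p} → Prime p → ∀ v → p ^ v ∣ B → p ^ v ≤ M)
    (smooth : ∀ {p} → Prime p → p ∣ B → p ≤ S + n) where

    Split : ℕ → ℕ → Set
    Split i bound = ∃[ X ] ∃[ Y ] (B ≡ X * Y × X ≤ bound × (∀ {p} → Prime p → p ≤ i → ¬ p ∣ Y))

    1≤Y : ∀ X Y → B ≡ X * Y → 1 ≤ Y
    1≤Y X zero eq = contradiction (subst (1 ≤_) (trans eq (*-zeroʳ X)) 1≤B) λ ()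
    1≤Y X (suc Y) eq = s≤s z≤n

    step : ∀ i bound b → 1 ≤ b → (∀ v → Prime (suc i) → suc i ^ v ∣ B → suc i ^ v ≤ b) → Split i bound → Split (suc i) (b * bound)
    step i bound b 1≤b hb (X , Y , eq , X≤ , none) with prime? (suc i)
    ... | no ¬pr = X , Y , eq , ≤-trans X≤ (m≤n*m bound b {{>-nonZero 1≤b}}) , none′
      where
      none′ : ∀ {p} → Prime p → p ≤ suc i → ¬ p ∣ Y
      none′ {p} pr p≤ with p ≟ suc i
      ... | yes refl = contradiction pr ¬pr
      ... | no ne = none pr (≤-pred (≤∧≢⇒< p≤ ne))
    ... | yes pr with factor-out (suc i) (prime⇒2≤ pr) Y (1≤Y X Y eq)
    ...   | v , Y′ , refl , p∤Y′ = suc i ^ v * X , Y′ , trans eq (lem X (suc i ^ v) Y′) ,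
              *-mono-≤ (hb v pr (subst (suc i ^ v ∣_) (sym (trans eq (lem′ X (suc i ^ v) Y′))) (m∣m*n _))) X≤ , none′
      where
      lem : ∀ x y z → x * (y * z) ≡ y * x * z
      lem = solve-∀
      lem′ : ∀ x y z → x * (y * z) ≡ y * (x * z)
      lem′ = solve-∀
      none′ : ∀ {p} → Prime p → p ≤ suc i → ¬ p ∣ Y′
      none′ {p} pr′ p≤ with p ≟ suc i
      ... | yes refl = p∤Y′
      ... | no ne = λ d → none pr′ (≤-pred (≤∧≢⇒< p≤ ne)) (∣n⇒∣m*n (suc i ^ v) d)

    small : ∀ i → Split i (M ^ i)
    small zero = 1 , B , sym (+-identityʳ B) , ≤-refl , λ pr p≤0 _ → <⇒≱ (prime⇒1≤ pr) p≤0
    small (suc i) = step i (M ^ i) M 1≤M (λ v pr d → pp pr v d) (small i)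

    large : ∀ j → Split (S + j) (primeProduct S j * M ^ S)
    large zero = subst₂ Split (sym (+-identityʳ S)) (sym (+-identityʳ (M ^ S))) (small S)
    large (suc j) = subst₂ Split (sym (+-suc S j)) (sym (*-assoc (primeOr1 (S + suc j)) (primeProduct S j) (M ^ S)))
        (step (S + j) (primeProduct S j * M ^ S) (primeOr1 (S + suc j)) (1≤primeOr1 (S + suc j)) hb (large j))
      where
      hb : ∀ v → Prime (suc (S + j)) → suc (S + j) ^ v ∣ B → suc (S + j) ^ v ≤ primeOr1 (S + suc j)
      hb v pr d rewrite +-suc S j with prime? (suc (S + j))
      ... | no ¬pr = contradiction pr ¬pr
      hb zero pr d | yes _ = s≤s z≤n
      hb (suc zero) pr d | yes _ = ≤-reflexive (*-identityʳ _)
      hb (suc (suc v)) pr d | yes _ = contradiction (≤-trans (pp pr (suc (suc v)) d) M≤S²) (<⇒≱ big)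
        where
        open ≤-Reasoning
        P = suc (S + j)
        S<P : S < P
        S<P = s≤s (m≤m+n S j)
        big : S * S < P ^ suc (suc v)
        big = begin-strict
          S * S             <⟨ *-mono-< S<P S<P ⟩
          P * P             ≤⟨ *-monoʳ-≤ P (m≤m*n P (P ^ v) {{m^n≢0 P v}}) ⟩
          P * (P * P ^ v)   ∎

    bound : B ≤ primeProduct S n * M ^ S
    bound with large n
    ... | X , Y , eq , X≤ , none = subst (_≤ primeProduct S n * M ^ S) (sym (trans eq (trans (cong (X *_) Y≡1) (*-identityʳ X)))) X≤
      where
      Y≡1 : Y ≡ 1
      Y≡1 = noPrimeDivisor⇒≡1 Y (1≤Y X Y eq)
        λ pr d → none pr (smooth pr (subst (_ ∣_) (sym eq) (∣n⇒∣m*n X d))) d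

  -- A prime in (n, 16n] for n a power of 4

  -- This bounds log₂(16n) by √n for n = 4^(4+g). It fixes the offset 4: with 3 in its place the
  -- case g = 0 would read 10 ≤ 8.
  2g+4≤2^g : ∀ g → 2 * (4 + g) + 4 ≤ 2 ^ (4 + g)
  2g+4≤2^g zero = m≤m+n 12 4
  2g+4≤2^g (suc g) = begin
    2 * (5 + g) + 4                     ≡⟨ lem g ⟩
    2 * (4 + g) + 4 + 2                 ≤⟨ +-mono-≤ (2g+4≤2^g g) (≤-trans (m≤n+m 2 (2 * (4 + g) + 2)) (≤-trans (≤-reflexive (lem′ g)) (2g+4≤2^g g))) ⟩
    2 ^ (4 + g) + 2 ^ (4 + g)           ≡⟨ cong (2 ^ (4 + g) +_) (+-identityʳ _) ⟨
    2 ^ (5 + g)                         ∎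
    where
    open ≤-Reasoning
    lem : ∀ g → 2 * (5 + g) + 4 ≡ 2 * (4 + g) + 4 + 2
    lem = solve-∀
    lem′ : ∀ g → 2 * (4 + g) + 2 + 2 ≡ 2 * (4 + g) + 4
    lem′ = solve-∀

  -- Otherwise lcm(1, ..., 16n) has only prime factors up to n. With x = √n, those up to 4x = √(16n)
  -- contribute at most (16n)^(4x) ≤ 2^(4n), and the others at most 2^(2n), against the lower bound
  -- 2^(8n).
  primeBetween : ∀ g → ∃[ p ] (Prime p × 2 ^ (2 * (4 + g)) < p × p ≤ 16 * 2 ^ (2 * (4 + g)))
  primeBetween g with anyUpTo? (λ p → prime? p ×-dec (n <? p)) (suc M)
    where
    n = 2 ^ (2 * (4 + g))
    M = 16 * n
  ... | yes (p , p< , pr , n<p) = p , pr , n<p , ≤-pred p<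
  ... | no none = ⊥-elim (<⇒≱ exponents (2^-cancel-≤ lower))
    where
    open ≤-Reasoning
    x n M S N : ℕ
    x = 2 ^ (4 + g)
    n = 2 ^ (2 * (4 + g))
    M = 16 * n
    S = 4 * x
    N = 8 * n
    n≡ : n ≡ x * x
    n≡ = trans (cong (2 ^_) (cong (4 + g +_) (+-identityʳ (4 + g)))) (^-distribˡ-+-* 2 (4 + g) (4 + g))
    4≤x : 4 ≤ x
    4≤x = ≤-trans (m≤n+m 4 (2 * (4 + g))) (2g+4≤2^g g)
    S≤n : S ≤ n
    S≤n = subst (S ≤_) (sym n≡) (*-monoˡ-≤ x 4≤x)
    M≡ : M ≡ S * S
    M≡ = trans (cong (16 *_) n≡) (lem x)
      where
      lem : ∀ x → 16 * (x * x) ≡ 4 * x * (4 * x)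
      lem = solve-∀
    M≡N+N : N + N ≡ M
    M≡N+N = sym (*-distribʳ-+ n 8 8)
    1≤M : 1 ≤ M
    1≤M = ≤-trans (m^n>0 2 (2 * (4 + g))) (m≤n*m n 16)
    smooth : ∀ {p} → Prime p → p ∣ lcmUpTo M → p ≤ S + (n ∸ S)
    smooth {p} pr d with n <? p
    ... | no ≮ = ≤-trans (≮⇒≥ ≮) (m≤n+m∸n n S)
    ... | yes n<p = contradiction
      (p , s≤s (subst (_≤ M) (*-identityʳ p) (primePower∣lcmUpTo⇒≤ pr 1 M 1≤M (subst (_∣ lcmUpTo M) (sym (*-identityʳ p)) d))) , pr , n<p) none
    2^-cancel-≤ : ∀ {i j} → 2 ^ i ≤ 2 ^ j → i ≤ j
    2^-cancel-≤ {i} {j} h = ≮⇒≥ λ j<i → <⇒≱ (^-monoʳ-< 2 (s≤s (s≤s z≤n)) j<i) h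
    E = 2 * (4 + g) + 4
    M≡2^E : M ≡ 2 ^ E
    M≡2^E = trans (*-comm 16 n) (sym (^-distribˡ-+-* 2 (2 * (4 + g)) 4))
    upper : lcmUpTo M ≤ primeProduct S (n ∸ S) * M ^ S
    upper = Smooth.bound (lcmUpTo M) M S (n ∸ S) (>-nonZero⁻¹ _ {{lcmUpTo≢0 M}}) (≤-reflexive M≡) 1≤M
      (λ pr v → primePower∣lcmUpTo⇒≤ pr v M 1≤M) smooth
    lower : 2 ^ N ≤ 2 ^ (2 * n + E * S)
    lower = begin
      2 ^ N                                        ≤⟨ subst (λ u → 2 ^ N ≤ lcmUpTo u) M≡N+N (2^m≤lcmUpTo N) ⟩
      lcmUpTo M                                    ≤⟨ upper ⟩
      -- Multiplying in the primes up to `S` completes the product to one over all primes up to `n`,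
      -- to which the doubling bound applies.
      primeProduct S (n ∸ S) * M ^ S               ≤⟨ *-monoˡ-≤ (M ^ S) (m≤n*m (primeProduct S (n ∸ S)) (primeProduct 0 S) {{>-nonZero (1≤primeProduct 0 S)}}) ⟩
      primeProduct 0 S * primeProduct S (n ∸ S) * M ^ S   ≡⟨ cong (_* M ^ S) (primeProduct-+ 0 S (n ∸ S)) ⟨
      primeProduct 0 (S + (n ∸ S)) * M ^ S         ≡⟨ cong (λ u → primeProduct 0 u * M ^ S) (m+[n∸m]≡n S≤n) ⟩
      primeProduct 0 n * M ^ S                     ≤⟨ *-monoˡ-≤ (M ^ S) (primeProduct-2^ (2 * (4 + g))) ⟩
      2 ^ (2 * n) * M ^ S                          ≡⟨ cong (λ u → 2 ^ (2 * n) * u ^ S) M≡2^E ⟩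
      2 ^ (2 * n) * (2 ^ E) ^ S                    ≡⟨ cong (2 ^ (2 * n) *_) (^-*-assoc 2 E S) ⟩
      2 ^ (2 * n) * 2 ^ (E * S)                    ≡⟨ ^-distribˡ-+-* 2 (2 * n) (E * S) ⟨
      2 ^ (2 * n + E * S)                          ∎
    exponents : 2 * n + E * S < N
    exponents = begin-strict
      2 * n + E * S                ≤⟨ +-monoʳ-≤ (2 * n) (*-monoˡ-≤ S (2g+4≤2^g g)) ⟩
      2 * n + x * (4 * x)          ≡⟨ cong (λ u → 2 * u + x * (4 * x)) n≡ ⟩
      2 * (x * x) + x * (4 * x)    ≡⟨ lem x ⟩
      6 * (x * x)                  <⟨ *-monoˡ-< (x * x) {{>-nonZero (*-mono-≤ 1≤x 1≤x)}} (m≤m+n 7 1) ⟩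
      8 * (x * x)                  ≡⟨ cong (8 *_) n≡ ⟨
      N ∎
      where
      1≤x : 1 ≤ x
      1≤x = ≤-trans (s≤s z≤n) 4≤x
      lem : ∀ x → 2 * (x * x) + x * (4 * x) ≡ 6 * (x * x)
      lem = solve-∀

  -- Rounds q up to a power of 4, of which the first available is 256 = 4·64; this is where `64 < q`
  -- comes from.
  bracket : ∀ q → 64 < q → ∃[ g ] (q ≤ 2 ^ (2 * (4 + g)) × 2 ^ (2 * (4 + g)) ≤ 4 * q)
  bracket (suc q) (s≤s 64≤q) with 64 <? q
  ... | no ≮ = 0 , ≤-trans (s≤s (≮⇒≥ ≮)) (m≤m+n 65 191) , *-monoʳ-≤ 4 (m≤n⇒m≤1+n 64≤q)
  ... | yes 64<q with bracket q 64<q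
  ...   | g , q≤ , ≤4q with suc q ≤? 2 ^ (2 * (4 + g))
  ...     | yes 1+q≤ = g , 1+q≤ , ≤-trans ≤4q (*-monoʳ-≤ 4 (n≤1+n q))
  ...     | no ≰ = suc g , ≤-trans (s≤s q≤) (subst (suc y ≤_) (sym y′≡) (subst (y <_) (*-comm y 4) (m<m*n y 4 {{>-nonZero 1≤y}} (s≤s (s≤s z≤n))))) ,
                  subst (_≤ 4 * suc q) (sym y′≡) (*-monoʳ-≤ 4 (<⇒≤ (≰⇒> ≰)))
    where
    y = 2 ^ (2 * (4 + g))
    1≤y : 1 ≤ y
    1≤y = m^n>0 2 (2 * (4 + g))
    y′≡ : 2 ^ (2 * (5 + g)) ≡ 4 * y
    y′≡ = trans (cong (2 ^_) (lem g)) (^-distribˡ-+-* 2 2 (2 * (4 + g)))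
      where
      lem : ∀ g → 2 * (5 + g) ≡ 2 + 2 * (4 + g)
      lem = solve-∀

  -- The factor 64 is the 4 lost in rounding times the 16 of `primeBetween`.
  prime-in-[q,64q] : ∀ q → 64 < q → ∃[ p ] (Prime p × q ≤ p × p ≤ 64 * q)
  prime-in-[q,64q] q 64<q with bracket q 64<q
  ... | g , q≤y , y≤4q with primeBetween g
  ...   | p , pr , y<p , p≤16y = p , pr , ≤-trans q≤y (<⇒≤ y<p) ,
    ≤-trans p≤16y (≤-trans (*-monoʳ-≤ 16 y≤4q) (≤-reflexive (sym (*-assoc 16 4 q))))

-- The polynomial method modulo p

module PolynomialMethod where

  import Data.Nat.Divisibility as ℕ
  import Data.Nat.DivMod as ℕ
  open import Data.Nat.Primality using (Prime; euclidsLemma; prime⇒nonZero; prime⇒nonTrivial)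
  open import Data.Integer as ℤ using (ℤ; +_; 0ℤ; 1ℤ; _+_; _-_; _*_; -_; ∣_∣)
  import Data.Integer.DivMod as ℤ
  open import Data.Integer.Divisibility.Signed using (_∣_; divides; ∣ᵤ⇒∣; ∣⇒∣ᵤ; ∣m∣n⇒∣m+n; ∣m∣n⇒∣m-n; ∣m⇒∣-m; ∣m⇒∣m*n; ∣n⇒∣m*n; _∣?_)
  import Data.Integer.Properties as ℤ
  open import Data.Integer.Tactic.RingSolver using (solve-∀)
  open import Data.Product.Function.NonDependent.Propositional using (_×-↔_)
  open import Data.Sum.Function.Propositional using (_⊎-↔_)
  open import Function.Construct.Composition using (_↔-∘_)
  open import Function.Construct.Identity using (↔-id)
  open import Algebra.Properties.Semiring.Sum ℤ.+-*-semiring using (sum; sum-cong-≗; ∑-distrib-+; *-distribˡ-sum; sum-remove)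
  open Primes using (prime-in-[q,64q])

  -- Newton interpolation

  ev : ∀ {R} → (Fin R → ℤ) → ℤ → ℤ
  ev {zero} φ x = 0ℤ
  ev {suc R} φ x = φ zero + x * ev (φ ∘ suc) x

  -- The coefficients of (φ(X) - φ(x₀)) / (X - x₀), by Horner's scheme.
  quot : ∀ {R} → (Fin (suc R) → ℤ) → ℤ → Fin R → ℤ
  quot {suc R} φ x₀ zero = ev (φ ∘ suc) x₀
  quot {suc R} φ x₀ (suc i) = quot (φ ∘ suc) x₀ i

  ev-quot : ∀ {R} (φ : Fin (suc R) → ℤ) x₀ x → (x - x₀) * ev (quot φ x₀) x ≡ ev φ x - ev φ x₀
  ev-quot {zero} φ x₀ x = lem (φ zero) x₀ x
    where
    lem : ∀ a x₀ x → (x - x₀) * 0ℤ ≡ (a + x * 0ℤ) - (a + x₀ * 0ℤ)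
    lem = solve-∀
  ev-quot {suc R} φ x₀ x = begin
    (x - x₀) * (B + x * A)            ≡⟨ lem₁ x x₀ A B ⟩
    (x - x₀) * B + x * ((x - x₀) * A) ≡⟨ cong (λ u → (x - x₀) * B + x * u) (ev-quot (φ ∘ suc) x₀ x) ⟩
    (x - x₀) * B + x * (ev (φ ∘ suc) x - B) ≡⟨ lem₂ (φ zero) x x₀ B (ev (φ ∘ suc) x) ⟩
    ev φ x - ev φ x₀ ∎
    where
    open ≡-Reasoning
    A = ev (quot (φ ∘ suc) x₀) x
    B = ev (φ ∘ suc) x₀
    lem₁ : ∀ x x₀ A B → (x - x₀) * (B + x * A) ≡ (x - x₀) * B + x * ((x - x₀) * A)
    lem₁ = solve-∀
    lem₂ : ∀ a x x₀ B C → (x - x₀) * B + x * (C - B) ≡ (a + x * C) - (a + x₀ * B)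
    lem₂ = solve-∀

  -- `f` is the cost of a divided difference and `g` that of undoing it. The sum serves as a common
  -- upper bound for the degree of the value at the node and that of the quotient's coefficients.
  interpDegree : (f g : ℕ → ℕ) → ℕ → ℕ → ℕ
  interpDegree f g zero d = 0
  interpDegree f g (suc R) d = g (d ℕ.+ interpDegree f g R (f d))

  -- Coefficients of a polynomial inherit any property of its values at sufficiently many
  -- points that survives the arithmetic of Newton interpolation.
  module Interpolation {L : Set} (Q : ℕ → (L → ℤ) → Set) (Λ : (L → ℤ) → Set)
    (Apart : (L → ℤ) → (L → ℤ) → Set) (f g : ℕ → ℕ)
    (mono : ∀ {d d′ u} → d ℕ.≤ d′ → Q d u → Q d′ u)
    (resp : ∀ {d u v} → (∀ ℓ → u ℓ ≡ v ℓ) → Q d u → Q d v)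
    (g-inc : ∀ d → d ℕ.≤ g d)
    (quo : ∀ {d x y u v h} → Λ x → Λ y → Apart x y → Q d u → Q d v →
           (∀ ℓ → (x ℓ - y ℓ) * h ℓ ≡ u ℓ - v ℓ) → Q (f d) h)
    (lin : ∀ {d x u v} → Λ x → Q d u → Q d v → Q (g d) (λ ℓ → u ℓ - x ℓ * v ℓ)) where

    -- With ψ the Horner quotient at x, the constant coefficient is φ(x) - x·ψ₀. Moreover ψ₀ is the
    -- value at x of `φ ∘ suc`, whose own quotient is the tail of ψ, so the recursion continues with
    -- the same node.
    recover : ∀ {R} (φ : Fin (suc R) → L → ℤ) (x : L → ℤ) d → Λ x →
      Q d (λ ℓ → ev (λ i → φ i ℓ) (x ℓ)) →
      (∀ i → Q d (λ ℓ → quot (λ i → φ i ℓ) (x ℓ) i)) → ∀ i → Q (g d) (φ i)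
    recover {zero} φ x d Λx Qv Qψ zero = mono (g-inc d) (resp (λ ℓ → lem (φ zero ℓ) (x ℓ)) Qv)
      where
      lem : ∀ a x → a + x * 0ℤ ≡ a
      lem = solve-∀
    recover {suc R} φ x d Λx Qv Qψ zero = resp (λ ℓ → lem (φ zero ℓ) (x ℓ) (ev (λ i → φ (suc i) ℓ) (x ℓ))) (lin Λx Qv (Qψ zero))
      where
      lem : ∀ a x b → (a + x * b) - x * b ≡ a
      lem = solve-∀
    recover {suc R} φ x d Λx Qv Qψ (suc i) = recover (φ ∘ suc) x d Λx (Qψ zero) (Qψ ∘ suc) i

    interpolate : ∀ R d (φ : Fin R → L → ℤ) (x : Fin R → L → ℤ) → (∀ k → Λ (x k)) →
      (∀ k k′ → k ≢ k′ → Apart (x k) (x k′)) →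
      (∀ k → Q d (λ ℓ → ev (λ i → φ i ℓ) (x k ℓ))) → ∀ i → Q (interpDegree f g R d) (φ i)
    interpolate (suc R) d φ x Λx ap Qv =
      recover φ (x zero) (d ℕ.+ interpDegree f g R (f d)) (Λx zero) (mono (ℕ.m≤m+n d _) (Qv zero))
        λ i → mono (ℕ.m≤n+m _ d)
          (interpolate R (f d) (λ i ℓ → quot (λ i → φ i ℓ) (x zero ℓ) i) (x ∘ suc) (Λx ∘ suc)
            (λ k k′ ne → ap (suc k) (suc k′) (ne ∘ Fin.suc-injective))
            (λ k → quo (Λx (suc k)) (Λx zero) (ap (suc k) zero λ ()) (Qv (suc k)) (Qv zero)
              (λ ℓ → ev-quot (λ i → φ i ℓ) (x zero ℓ) (x (suc k) ℓ)))
            i)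

  -- Arithmetic modulo p

  module Mod (p : ℕ) (pr : Prime p) where

    Zero : ℤ → Set
    Zero x = + p ∣ x

    Zero? : ∀ x → Dec (Zero x)
    Zero? x = + p ∣? x

    Zero-0 : Zero 0ℤ
    Zero-0 = divides 0ℤ refl

    Zero-resp : ∀ {x y} → x ≡ y → Zero x → Zero y
    Zero-resp refl z = z

    Zero-domain : ∀ x y → Zero (x * y) → Zero x ⊎ Zero y
    Zero-domain x y z with euclidsLemma ∣ x ∣ ∣ y ∣ pr (subst (p ℕ.∣_) (ℤ.abs-* x y) (∣⇒∣ᵤ z))
    ... | inj₁ d = inj₁ (∣ᵤ⇒∣ d)
    ... | inj₂ d = inj₂ (∣ᵤ⇒∣ d)

    ¬Zero-* : ∀ x y → ¬ Zero x → ¬ Zero y → ¬ Zero (x * y)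
    ¬Zero-* x y nx ny z with Zero-domain x y z
    ... | inj₁ d = nx d
    ... | inj₂ d = ny d

    ¬Zero-1 : ¬ Zero 1ℤ
    ¬Zero-1 z = ℕ.<⇒≱ (ℕ.nonTrivial⇒n>1 p {{prime⇒nonTrivial pr}}) (ℕ.∣⇒≤ (∣⇒∣ᵤ z))

    residues-equal′ : ∀ x y → y ℕ.≤ x → x ℕ.< p → Zero (+ x - + y) → x ≡ y
    residues-equal′ x y y≤x x<p z with x ℕ.∸ y in eq
    ... | zero = ℕ.≤-antisym (ℕ.m∸n≡0⇒m≤n eq) y≤x
    ... | suc d = contradiction (ℕ.∣⇒≤ (subst (p ℕ.∣_) eq′ (∣⇒∣ᵤ z))) (ℕ.<⇒≱ (ℕ.≤-<-trans (subst (ℕ._≤ x) eq (ℕ.m∸n≤m x y)) x<p))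
      where
      eq′ : ∣ + x - + y ∣ ≡ suc d
      eq′ = trans (cong ∣_∣ (trans (ℤ.m-n≡m⊖n x y) (ℤ.⊖-≥ y≤x))) eq

    residues-equal : ∀ x y → x ℕ.< p → y ℕ.< p → Zero (+ x - + y) → x ≡ y
    residues-equal x y x<p y<p z with ℕ.≤-total x y
    ... | inj₂ y≤x = residues-equal′ x y y≤x x<p z
    ... | inj₁ x≤y = sym (residues-equal′ y x x≤y y<p (Zero-resp (flip (+ x) (+ y)) (∣m⇒∣-m z)))
      where
      flip : ∀ x y → - (x - y) ≡ y - x
      flip = solve-∀

    -- Interpolation for the property of being divisible by p: it passes to divided differences
    -- because the nodes differ modulo p.
    roots⇒Zero : ∀ w (e : Fin w → ℤ) (x : Fin w → ℤ) → (∀ k k′ → k ≢ k′ → ¬ Zero (x k - x k′)) →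
      (∀ k → Zero (ev e (x k))) → ∀ i → Zero (e i)
    roots⇒Zero w e x ap zs = I.interpolate w 0 (λ i _ → e i) (λ k _ → x k) (λ _ → tt) ap zs
      where
      quo : ∀ {d : ℕ} {x y u v h : ⊤ → ℤ} → ⊤ → ⊤ → ¬ Zero (x tt - y tt) → Zero (u tt) → Zero (v tt) →
        (∀ ℓ → (x ℓ - y ℓ) * h ℓ ≡ u ℓ - v ℓ) → Zero (h tt)
      quo {x = x} {y} {h = h} _ _ ap zu zv eq with Zero-domain (x tt - y tt) (h tt) (Zero-resp (sym (eq tt)) (∣m∣n⇒∣m-n zu zv))
      ... | inj₁ z = contradiction z ap
      ... | inj₂ z = z
      module I = Interpolation {⊤} (λ _ u → Zero (u tt)) (λ _ → ⊤) (λ x y → ¬ Zero (x tt - y tt)) id id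
        (λ _ z → z) (λ eq z → Zero-resp (eq tt) z) (λ _ → ℕ.≤-refl)
        (λ {d} {x} {y} {u} {v} {h} → quo {d} {x} {y} {u} {v} {h})
        (λ {d} {x} {u} {v} _ zu zv → ∣m∣n⇒∣m-n zu (∣n⇒∣m*n (x tt) zv))

    Zero-sum : ∀ {K} (a : Fin K → ℤ) → (∀ i → Zero (a i)) → Zero (sum a)
    Zero-sum {zero} a z = Zero-0
    Zero-sum {suc K} a z = ∣m∣n⇒∣m+n (z zero) (Zero-sum (a ∘ suc) (z ∘ suc))

    Zero-sum-cong : ∀ {K} (a b : Fin K → ℤ) → (∀ i → Zero (b i - a i)) → Zero (sum a) → Zero (sum b)
    Zero-sum-cong a b d z = Zero-resp
      (trans (sym (∑-distrib-+ a (λ i → b i - a i))) (sum-cong-≗ λ i → lem (a i) (b i)))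
      (∣m∣n⇒∣m+n z (Zero-sum (λ i → b i - a i) d))
      where
      lem : ∀ a b → a + (b - a) ≡ b
      lem = solve-∀

    ∏ : ∀ {n} → (Fin n → ℤ) → ℤ
    ∏ {zero} a = 1ℤ
    ∏ {suc n} a = a zero * ∏ (a ∘ suc)

    ¬Zero-∏ : ∀ {n} (a : Fin n → ℤ) → (∀ i → ¬ Zero (a i)) → ¬ Zero (∏ a)
    ¬Zero-∏ {zero} a nz = ¬Zero-1
    ¬Zero-∏ {suc n} a nz = ¬Zero-* _ _ (nz zero) (¬Zero-∏ (a ∘ suc) (nz ∘ suc))

    Zero-∏ : ∀ {n} (a : Fin n → ℤ) i → Zero (a i) → Zero (∏ a)
    Zero-∏ a zero z = ∣m⇒∣m*n _ z
    Zero-∏ a (suc i) z = ∣n⇒∣m*n (a zero) (Zero-∏ (a ∘ suc) i z)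

  -- Polynomial functions, tested by weights on a finite set of points

  monomial : ∀ {V} → (Fin V → ℕ) → (Fin V → ℕ) → ℕ
  monomial {zero} z e = 1
  monomial {suc V} z e = z zero ℕ.^ e zero ℕ.* monomial (z ∘ suc) (e ∘ suc)

  bump : ∀ {V} → Fin V → (Fin V → ℕ) → Fin V → ℕ
  bump zero e zero = suc (e zero)
  bump zero e (suc i) = e (suc i)
  bump (suc v) e zero = e zero
  bump (suc v) e (suc i) = bump v (e ∘ suc) i

  bump-≤ : ∀ {V} (v : Fin V) e {D} → (∀ i → e i ℕ.≤ D) → ∀ i → bump v e i ℕ.≤ suc D
  bump-≤ zero e le zero = s≤s (le zero)
  bump-≤ zero e le (suc i) = ℕ.m≤n⇒m≤1+n (le (suc i))
  bump-≤ (suc v) e le zero = ℕ.m≤n⇒m≤1+n (le zero)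
  bump-≤ (suc v) e le (suc i) = bump-≤ v (e ∘ suc) (le ∘ suc) i

  monomial-bump : ∀ {V} (z e : Fin V → ℕ) v → monomial z (bump v e) ≡ z v ℕ.* monomial z e
  monomial-bump z e zero = ℕ.*-assoc (z zero) _ _
  monomial-bump z e (suc v) rewrite monomial-bump (z ∘ suc) (e ∘ suc) v = lem (z zero ℕ.^ e zero) (z (suc v)) _
    where
    lem : ∀ a b c → a ℕ.* (b ℕ.* c) ≡ b ℕ.* (a ℕ.* c)
    lem = ℕ.solve-∀

  -- ψ is a weight on the points Fin K, carried by Supp; z gives the coordinates of the points.
  -- `Kills D u` says that ψ·u annihilates all monomials with exponents at most D, and
  -- `Poly d g` that multiplication by g costs at most d exponents: this holds for every
  -- function that is given mod p on Supp by a polynomial with exponents at most d.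
  module Weights (p : ℕ) (pr : Prime p) (K V : ℕ) (ψ : Fin K → ℤ) (z : Fin V → Fin K → ℕ)
    (Supp : Fin K → Set) (supp : ∀ ℓ → ψ ℓ ≡ 0ℤ ⊎ Supp ℓ) where

    open Mod p pr

    term : (Fin V → ℕ) → (Fin K → ℤ) → Fin K → ℤ
    term e u ℓ = ψ ℓ * (u ℓ * + monomial (λ v → z v ℓ) e)

    Kills : ℕ → (Fin K → ℤ) → Set
    Kills D u = ∀ e → (∀ v → e v ℕ.≤ D) → Zero (sum (term e u))

    Poly : ℕ → (Fin K → ℤ) → Set
    Poly d g = ∀ D u → Kills (d ℕ.+ D) u → Kills D (λ ℓ → u ℓ * g ℓ)

    -- Off `Supp` both terms vanish together with ψ. Asking for the congruence on `Supp` only is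
    -- what allows the equations valid on one chart to be used as identities.
    Kills-cong : ∀ {D u v} → (∀ ℓ → Supp ℓ → Zero (v ℓ - u ℓ)) → Kills D u → Kills D v
    Kills-cong {D} {u} {v} eq kill e le = Zero-sum-cong (term e u) (term e v) diff (kill e le)
      where
      lem : ∀ a u v m → a * (v * m) - a * (u * m) ≡ a * m * (v - u)
      lem = solve-∀
      diff : ∀ ℓ → Zero (term e v ℓ - term e u ℓ)
      diff ℓ with supp ℓ
      ... | inj₁ eq₀ rewrite eq₀ = Zero-0
      ... | inj₂ s = Zero-resp (sym (lem (ψ ℓ) (u ℓ) (v ℓ) (+ monomial (λ v → z v ℓ) e))) (∣n⇒∣m*n (ψ ℓ * + monomial (λ v → z v ℓ) e) (eq ℓ s))

    Zero-refl : ∀ {x y} → x ≡ y → Zero (y - x)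
    Zero-refl {x} refl = Zero-resp (sym (ℤ.+-inverseʳ x)) Zero-0

    Poly-cong : ∀ {d g h} → (∀ ℓ → Supp ℓ → Zero (h ℓ - g ℓ)) → Poly d g → Poly d h
    Poly-cong {g = g} {h} eq P D u kill = Kills-cong {D} {λ ℓ → u ℓ * g ℓ} {λ ℓ → u ℓ * h ℓ}
      (λ ℓ s → Zero-resp (lem (u ℓ) (h ℓ) (g ℓ)) (∣n⇒∣m*n (u ℓ) (eq ℓ s))) (P D u kill)
      where
      lem : ∀ u h g → u * (h - g) ≡ u * h - u * g
      lem = solve-∀

    Poly-≗ : ∀ {d g h} → (∀ ℓ → Supp ℓ → g ℓ ≡ h ℓ) → Poly d g → Poly d h
    Poly-≗ eq = Poly-cong λ ℓ s → Zero-refl (eq ℓ s)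

    Poly-const : ∀ {d} c → Poly d (λ _ → c)
    Poly-const {d} c D u kill e le = Zero-resp
      (trans (*-distribˡ-sum c (term e u)) (sum-cong-≗ λ ℓ → lem c (ψ ℓ) (u ℓ) (+ monomial (λ v → z v ℓ) e)))
      (∣n⇒∣m*n c (kill e λ v → ℕ.≤-trans (le v) (ℕ.m≤n+m D d)))
      where
      lem : ∀ c a u m → c * (a * (u * m)) ≡ a * (u * c * m)
      lem = solve-∀

    Poly-var : ∀ v → Poly 1 (λ ℓ → + z v ℓ)
    Poly-var v D u kill e le = Zero-resp (sum-cong-≗ eq) (kill (bump v e) (bump-≤ v e le))
      where
      lem : ∀ a u x m → a * (u * (x * m)) ≡ a * (u * x * m)
      lem = solve-∀
      eq : ∀ ℓ → term (bump v e) u ℓ ≡ term e (λ ℓ → u ℓ * + z v ℓ) ℓ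
      eq ℓ = trans (cong (λ m → ψ ℓ * (u ℓ * m))
          (trans (cong +_ (monomial-bump (λ v → z v ℓ) e v)) (ℤ.pos-* (z v ℓ) _)))
        (lem (ψ ℓ) (u ℓ) (+ z v ℓ) (+ monomial (λ v → z v ℓ) e))

    Poly-+ : ∀ {d g h} → Poly d g → Poly d h → Poly d (λ ℓ → g ℓ + h ℓ)
    Poly-+ {d} {g} {h} Pg Ph D u kill e le = Zero-resp
      (trans (sym (∑-distrib-+ (term e (λ ℓ → u ℓ * g ℓ)) (term e (λ ℓ → u ℓ * h ℓ))))
        (sum-cong-≗ λ ℓ → lem (ψ ℓ) (u ℓ) (g ℓ) (h ℓ) (+ monomial (λ v → z v ℓ) e)))
      (∣m∣n⇒∣m+n (Pg D u kill e le) (Ph D u kill e le))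
      where
      lem : ∀ a u g h m → a * (u * g * m) + a * (u * h * m) ≡ a * (u * (g + h) * m)
      lem = solve-∀

    Poly-* : ∀ {d d′ g h} → Poly d g → Poly d′ h → Poly (d ℕ.+ d′) (λ ℓ → g ℓ * h ℓ)
    Poly-* {d} {d′} {g} {h} Pg Ph D u kill =
      Kills-cong {D} {λ ℓ → u ℓ * g ℓ * h ℓ} {λ ℓ → u ℓ * (g ℓ * h ℓ)} (λ ℓ _ → Zero-refl (ℤ.*-assoc (u ℓ) (g ℓ) (h ℓ)))
        (Ph D (λ ℓ → u ℓ * g ℓ) (Pg (d′ ℕ.+ D) u (subst (λ m → Kills m u) (ℕ.+-assoc d d′ D) kill)))

    Poly-mono : ∀ {d d′ g} → d ℕ.≤ d′ → Poly d g → Poly d′ g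
    Poly-mono d≤d′ P D u kill = P D u λ e le → kill e λ v → ℕ.≤-trans (le v) (ℕ.+-monoˡ-≤ D d≤d′)

    Poly-scale : ∀ {d g} c → Poly d g → Poly d (λ ℓ → c * g ℓ)
    Poly-scale c P = Poly-* (Poly-const {0} c) P

    Poly-- : ∀ {d g h} → Poly d g → Poly d h → Poly d (λ ℓ → g ℓ - h ℓ)
    Poly-- {g = g} {h} Pg Ph = Poly-≗ (λ ℓ _ → lem (g ℓ) (h ℓ)) (Poly-+ Pg (Poly-scale (- 1ℤ) Ph))
      where
      lem : ∀ g h → g + - 1ℤ * h ≡ g - h
      lem = solve-∀

    Poly-sum : ∀ {d n} (g : Fin n → Fin K → ℤ) → (∀ i → Poly d (g i)) → Poly d (λ ℓ → sum (λ i → g i ℓ))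
    Poly-sum {n = zero} g P = Poly-const 0ℤ
    Poly-sum {n = suc n} g P = Poly-+ (P zero) (Poly-sum (g ∘ suc) (P ∘ suc))

    Poly-∏ : ∀ {d n} (g : Fin n → Fin K → ℤ) → (∀ i → Poly d (g i)) → Poly (n ℕ.* d) (λ ℓ → ∏ (λ i → g i ℓ))
    Poly-∏ {n = zero} g P = Poly-const 1ℤ
    Poly-∏ {n = suc n} g P = Poly-* (P zero) (Poly-∏ (g ∘ suc) (P ∘ suc))

    Poly-ev : ∀ {d n e} (φ : Fin n → Fin K → ℤ) (x : Fin K → ℤ) → (∀ i → Poly d (φ i)) → Poly e x →
      Poly (d ℕ.+ n ℕ.* e) (λ ℓ → ev (λ i → φ i ℓ) (x ℓ))
    Poly-ev {n = zero} φ x Pφ Px = Poly-const 0ℤ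
    Poly-ev {d} {suc n} {e} φ x Pφ Px = Poly-+ (Poly-mono (ℕ.m≤m+n d _) (Pφ zero))
      (Poly-mono (ℕ.≤-reflexive (lem d e (n ℕ.* e))) (Poly-* Px (Poly-ev (φ ∘ suc) x (Pφ ∘ suc) Px)))
      where
      lem : ∀ d e m → e ℕ.+ (d ℕ.+ m) ≡ d ℕ.+ (e ℕ.+ m)
      lem = ℕ.solve-∀

    -- Take u = 1 and D = 0: the only monomial left to test against is 1.
    Poly⇒annihilated : ∀ {d g} → Poly d g → Kills d (λ _ → 1ℤ) → Zero (sum (λ ℓ → ψ ℓ * g ℓ))
    Poly⇒annihilated {d} {g} P kill = Zero-resp (sum-cong-≗ eq)
      (P 0 (λ _ → 1ℤ) (subst (λ m → Kills m (λ _ → 1ℤ)) (sym (ℕ.+-identityʳ d)) kill) (λ _ → 0) (λ _ → z≤n))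
      where
      monomial-0 : ∀ {V} (z : Fin V → ℕ) → monomial z (λ _ → 0) ≡ 1
      monomial-0 {zero} z = refl
      monomial-0 {suc V} z = trans (ℕ.+-identityʳ _) (monomial-0 (z ∘ suc))
      eq : ∀ ℓ → term (λ _ → 0) (λ ℓ → 1ℤ * g ℓ) ℓ ≡ ψ ℓ * g ℓ
      eq ℓ rewrite monomial-0 (λ v → z v ℓ) = cong (ψ ℓ *_) (trans (ℤ.*-identityʳ _) (ℤ.*-identityˡ _))

    -- A function that modulo p is a fraction of polynomials. It keeps its own integer values, so
    -- the numerator is `den · g`; invertibility of the denominator is asked for on the chart only.
    record Rat (d : ℕ) (g : Fin K → ℤ) : Set where
      constructor rat
      field
        den : Fin K → ℤ
        den-poly : Poly d den
        num-poly : Poly d (λ ℓ → den ℓ * g ℓ)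
        den-apart : ∀ ℓ → Supp ℓ → ¬ Zero (den ℓ)

    Poly⇒Rat : ∀ {d g} → Poly d g → Rat d g
    Poly⇒Rat {g = g} P = rat (λ _ → 1ℤ) (Poly-const 1ℤ) (Poly-≗ (λ ℓ _ → sym (ℤ.*-identityˡ (g ℓ))) P) (λ _ _ → ¬Zero-1)

    Rat-mono : ∀ {d d′ g} → d ℕ.≤ d′ → Rat d g → Rat d′ g
    Rat-mono le (rat δ P N A) = rat δ (Poly-mono le P) (Poly-mono le N) A

    Rat-≗ : ∀ {d g h} → (∀ ℓ → g ℓ ≡ h ℓ) → Rat d g → Rat d h
    Rat-≗ eq (rat δ P N A) = rat δ P (Poly-≗ (λ ℓ _ → cong (δ ℓ *_) (eq ℓ)) N) A

    Rat-lin : ∀ {e d x u v} → Poly e x → Rat d u → Rat d v → Rat (d ℕ.+ (e ℕ.+ d)) (λ ℓ → u ℓ - x ℓ * v ℓ)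
    Rat-lin {e} {d} {x} {u} {v} Px (rat δ P N A) (rat δ′ P′ N′ A′) = rat (λ ℓ → δ ℓ * δ′ ℓ)
      (Poly-* P (Poly-mono (ℕ.m≤n+m d e) P′))
      (Poly-≗ (λ ℓ _ → lem (δ ℓ) (δ′ ℓ) (u ℓ) (x ℓ) (v ℓ))
        (Poly-- (Poly-* N (Poly-mono (ℕ.m≤n+m d e) P′)) (Poly-* P (Poly-* Px N′))))
      (λ ℓ s → ¬Zero-* _ _ (A ℓ s) (A′ ℓ s))
      where
      lem : ∀ δ δ′ u x v → δ * u * δ′ - δ * (x * (δ′ * v)) ≡ δ * δ′ * (u - x * v)
      lem = solve-∀

    Rat-quo : ∀ {e d x y u v h} → Poly e x → Poly e y → (∀ ℓ → Supp ℓ → ¬ Zero (x ℓ - y ℓ)) →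
      Rat d u → Rat d v → (∀ ℓ → (x ℓ - y ℓ) * h ℓ ≡ u ℓ - v ℓ) → Rat (e ℕ.+ (d ℕ.+ d)) h
    Rat-quo {e} {d} {x} {y} {u} {v} {h} Px Py ap (rat δ P N A) (rat δ′ P′ N′ A′) eq = rat
      (λ ℓ → (x ℓ - y ℓ) * (δ ℓ * δ′ ℓ))
      (Poly-* (Poly-- Px Py) (Poly-* P P′))
      (Poly-mono (ℕ.m≤n+m _ e) (Poly-≗ num (Poly-- (Poly-* N P′) (Poly-* P N′))))
      (λ ℓ s → ¬Zero-* _ _ (ap ℓ s) (¬Zero-* _ _ (A ℓ s) (A′ ℓ s)))
      where
      lem : ∀ δ δ′ u v → δ * u * δ′ - δ * (δ′ * v) ≡ δ * δ′ * (u - v)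
      lem = solve-∀
      lem′ : ∀ δ δ′ a h → δ * δ′ * (a * h) ≡ a * (δ * δ′) * h
      lem′ = solve-∀
      num : ∀ ℓ → Supp ℓ → δ ℓ * u ℓ * δ′ ℓ - δ ℓ * (δ′ ℓ * v ℓ) ≡ (x ℓ - y ℓ) * (δ ℓ * δ′ ℓ) * h ℓ
      num ℓ _ = trans (lem (δ ℓ) (δ′ ℓ) (u ℓ) (v ℓ)) (trans (cong (δ ℓ * δ′ ℓ *_) (sym (eq ℓ))) (lem′ (δ ℓ) (δ′ ℓ) (x ℓ - y ℓ) (h ℓ)))

    module RatInterpolation (e : ℕ) = Interpolation Rat (Poly e) (λ x y → ∀ ℓ → Supp ℓ → ¬ Zero (x ℓ - y ℓ))
      (λ d → e ℕ.+ (d ℕ.+ d)) (λ d → d ℕ.+ (e ℕ.+ d)) Rat-mono Rat-≗ (λ d → ℕ.m≤m+n d _) Rat-quo Rat-lin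

  -- Separating points by a linear projection

  cons : ∀ {a n} → (Fin a → Fin n) → Fin (suc a) → Fin (suc n)
  cons ι zero = zero
  cons ι (suc k) = suc (ι k)

  cons-injective : ∀ {a n} (ι : Fin a → Fin n) → Injective _≡_ _≡_ ι → Injective _≡_ _≡_ (cons ι)
  cons-injective ι inj {zero} {zero} _ = refl
  cons-injective ι inj {suc x} {suc y} eq = cong suc (inj (Fin.suc-injective eq))

  Subfamily : ∀ {n} → ℕ → (Fin n → Set) → Set
  Subfamily {n} a P = Σ (Fin a → Fin n) λ ι → Injective _≡_ _≡_ ι × (∀ k → P (ι k))

  split-pigeonhole : ∀ n a b → a ℕ.+ b ℕ.≤ suc n → (P : Fin n → Set) → Decidable P →
    Subfamily a P ⊎ Subfamily b (¬_ ∘ P)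
  split-pigeonhole n zero b le P P? = inj₁ ((λ ()) , (λ {x} → λ { }) , λ ())
  split-pigeonhole n (suc a) zero le P P? = inj₂ ((λ ()) , (λ {x} → λ { }) , λ ())
  split-pigeonhole zero (suc a) (suc b) (s≤s le) P P? = contradiction (subst (ℕ._≤ 0) (ℕ.+-suc a b) le) λ ()
  split-pigeonhole (suc n) (suc a) (suc b) (s≤s le) P P? with P? zero
  ... | yes p₀ with split-pigeonhole n a (suc b) le (P ∘ suc) (P? ∘ suc)
  ...   | inj₂ (ι , inj , np) = inj₂ (suc ∘ ι , inj ∘ Fin.suc-injective , np)
  ...   | inj₁ (ι , inj , ps) = inj₁ (cons ι , cons-injective ι inj , λ { zero → p₀ ; (suc k) → ps k })
  split-pigeonhole (suc n) (suc a) (suc b) (s≤s le) P P? | no ¬p₀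
    with split-pigeonhole n (suc a) b (subst (ℕ._≤ suc n) (ℕ.+-suc a b) le) (P ∘ suc) (P? ∘ suc)
  ...   | inj₁ (ι , inj , ps) = inj₁ (suc ∘ ι , inj ∘ Fin.suc-injective , ps)
  ...   | inj₂ (ι , inj , np) = inj₂ (cons ι , cons-injective ι inj , λ { zero → ¬p₀ ; (suc k) → np k })

  ev-- : ∀ {w} (a b : Fin w → ℤ) x → ev (λ i → a i - b i) x ≡ ev a x - ev b x
  ev-- {zero} a b x = refl
  ev-- {suc w} a b x rewrite ev-- (a ∘ suc) (b ∘ suc) x = lem (a zero) (b zero) x (ev (a ∘ suc) x) (ev (b ∘ suc) x)
    where
    lem : ∀ a b x c d → (a - b) + x * (c - d) ≡ (a + x * c) - (b + x * d)
    lem = solve-∀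

  ev-cong : ∀ {w} {a b : Fin w → ℤ} x → (∀ i → a i ≡ b i) → ev a x ≡ ev b x
  ev-cong {zero} x eq = refl
  ev-cong {suc w} x eq = cong₂ (λ u v → u + x * v) (eq zero) (ev-cong x (eq ∘ suc))

  module Separation (p : ℕ) (pr : Prime p) where
    open Mod p pr

    -- A nonzero polynomial with w coefficients cannot vanish at w of the points. Hence each of the
    -- N polynomials can be made to use up w points, and one point is left at the end.
    nonroot : ∀ w N (e : Fin N → Fin w → ℤ) (ι : Fin (suc (N ℕ.* w)) → ℕ) → Injective _≡_ _≡_ ι → (∀ x → ι x ℕ.< p) →
      ∃[ x ] (∀ k → (∃[ i ] ¬ Zero (e k i)) → ¬ Zero (ev (e k) (+ ι x)))
    nonroot w zero e ι inj ι<p = zero , λ ()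
    nonroot w (suc N) e ι inj ι<p with Fin.any? (λ i → ¬? (Zero? (e zero i)))
    ... | no none = let x , good = nonroot w N (e ∘ suc) (ι ∘ emb) (Fin.inject≤-injective _ _ _ _ ∘ inj) (λ x → ι<p (emb x)) in
          emb x , λ { zero nz → contradiction nz none ; (suc k) → good k }
      where
      emb : Fin (suc (N ℕ.* w)) → Fin (suc (suc N ℕ.* w))
      emb x = Fin.inject≤ x (s≤s (ℕ.m≤n+m _ w))
    ... | yes (i , nz) with split-pigeonhole _ w (suc (N ℕ.* w)) (subst (ℕ._≤ suc (suc (suc N ℕ.* w))) (sym (ℕ.+-suc w (N ℕ.* w))) (ℕ.n≤1+n _))
                              (λ x → Zero (ev (e zero) (+ ι x))) (λ x → Zero? _)
    ...   | inj₁ (κ , κ-inj , roots) = contradiction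
              (roots⇒Zero w (e zero) (λ k → + ι (κ k))
                (λ k k′ ne z → ne (κ-inj (inj (residues-equal _ _ (ι<p (κ k)) (ι<p (κ k′)) z)))) roots i) nz
    ...   | inj₂ (κ , κ-inj , nonroots) =
              let x , good = nonroot w N (e ∘ suc) (ι ∘ κ) (κ-inj ∘ inj) (λ x → ι<p (κ x)) in
              κ x , λ { zero _ → nonroots x ; (suc k) → good k }

    -- Projection along (1, τ, τ², ...) turns the difference of two distinct points into a nonzero
    -- polynomial in τ, and τ has to avoid the roots of at most R·R of these.
    separate : ∀ w R (E : Fin R → Fin w → ℕ) → suc (R ℕ.* R ℕ.* w) ℕ.≤ p → (∀ k i → E k i ℕ.< p) →
      (∀ k k′ → k ≢ k′ → ¬ (∀ i → E k i ≡ E k′ i)) →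
      ∃[ τ ] (∀ k k′ → k ≢ k′ → ¬ Zero (ev (λ i → + E k i) (+ toℕ {suc (R ℕ.* R ℕ.* w)} τ) - ev (λ i → + E k′ i) (+ toℕ τ)))
    separate w R E T≤p E<p ne with nonroot w (R ℕ.* R) e toℕ Fin.toℕ-injective (λ x → ℕ.<-≤-trans (Fin.toℕ<n x) T≤p)
      where
      e : Fin (R ℕ.* R) → Fin w → ℤ
      e n i = + E (proj₁ (remQuot {R} R n)) i - + E (proj₂ (remQuot {R} R n)) i
    ... | τ , good = τ , λ k k′ k≢k′ → subst (λ kk → ¬ Zero (ev (λ i → + E (proj₁ kk) i) (+ toℕ τ) - ev (λ i → + E (proj₂ kk) i) (+ toℕ τ)))
                           (Fin.remQuot-combine k k′)
                           (λ z → good (combine k k′) (nz k k′ k≢k′) (Zero-resp (sym (ev--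
                             (λ i → + E (proj₁ (remQuot {R} R (combine k k′))) i) (λ i → + E (proj₂ (remQuot {R} R (combine k k′))) i) (+ toℕ τ))) z))
      where
      nz : ∀ k k′ → k ≢ k′ → ∃[ i ] ¬ Zero (+ E (proj₁ (remQuot {R} R (combine k k′))) i - + E (proj₂ (remQuot {R} R (combine k k′))) i)
      nz k k′ k≢k′ with Fin.¬∀⟶∃¬ w (λ i → E k i ≡ E k′ i) (λ i → E k i ℕ.≟ E k′ i) (ne k k′ k≢k′)
      ... | i , neq = i , subst (λ kk → ¬ Zero (+ E (proj₁ kk) i - + E (proj₂ kk) i)) (sym (Fin.remQuot-combine k k′))
                            (λ z → neq (residues-equal _ _ (E<p k i) (E<p k′ i) z))

  -- The dimension bound

  restrict : ∀ {K X} → (Fin K → Fin X) → Fin X → (Fin K → ℤ) → Fin K → ℤ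
  restrict chart χ ψ ℓ with chart ℓ Fin.≟ χ
  ... | yes _ = ψ ℓ
  ... | no _ = 0ℤ

  restrict-supp : ∀ {K X} (chart : Fin K → Fin X) χ ψ ℓ → restrict chart χ ψ ℓ ≡ 0ℤ ⊎ chart ℓ ≡ χ
  restrict-supp chart χ ψ ℓ with chart ℓ Fin.≟ χ
  ... | yes eq = inj₂ eq
  ... | no _ = inj₁ refl

  restrict-≡ : ∀ {K X} (chart : Fin K → Fin X) ψ ℓ → restrict chart (chart ℓ) ψ ℓ ≡ ψ ℓ
  restrict-≡ chart ψ ℓ with chart ℓ Fin.≟ chart ℓ
  ... | yes _ = refl
  ... | no ne = contradiction refl ne

  restrict-- : ∀ {K X} (chart : Fin K → Fin X) χ a b ℓ →
    restrict chart χ (λ ℓ → a ℓ - b ℓ) ℓ ≡ restrict chart χ a ℓ - restrict chart χ b ℓ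
  restrict-- chart χ a b ℓ with chart ℓ Fin.≟ χ
  ... | yes _ = refl
  ... | no _ = refl

  finToFun-injective : ∀ {m n} {i j : Fin (m ℕ.^ n)} → (∀ x → finToFun {m} {n} i x ≡ finToFun j x) → i ≡ j
  finToFun-injective {m} {n} {i} {j} eq = trans (sym (Fin.funToFin-finToFin {n} {m} i)) (trans (funToFin-cong eq) (Fin.funToFin-finToFin {n} {m} j))
    where
    funToFin-cong : ∀ {n} {f g : Fin n → Fin m} → (∀ x → f x ≡ g x) → funToFin f ≡ funToFin g
    funToFin-cong {zero} eq = refl
    funToFin-cong {suc n} eq = cong₂ combine (eq zero) (funToFin-cong (eq ∘ suc))

  module Dimension (p : ℕ) (pr : Prime p) (K X V d : ℕ) (chart : Fin K → Fin X) (z : Fin V → Fin K → ℕ) where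
    open Mod p pr

    private
      instance
        p≢0 : ℕ.NonZero p
        p≢0 = prime⇒nonZero pr

    -- Otherwise, by the pigeonhole principle, some nonzero weight annihilates all monomials
    -- on every chart; pair it with the indicator of a point in its support.
    bound : (∀ ψ ℓ₀ (supp : ∀ ℓ → ψ ℓ ≡ 0ℤ ⊎ chart ℓ ≡ chart ℓ₀) →
               ∃[ g ] (Weights.Poly p pr K V ψ z (λ ℓ → chart ℓ ≡ chart ℓ₀) supp d g ×
                       ¬ Zero (g ℓ₀) × (∀ ℓ → ℓ ≢ ℓ₀ → chart ℓ ≡ chart ℓ₀ → Zero (g ℓ)))) →
      K ℕ.≤ X ℕ.* suc d ℕ.^ V
    bound indicator with K ℕ.≤? X ℕ.* suc d ℕ.^ V
    ... | yes le = le
    -- There are p^K weights with values below p, but only p^(X·(d+1)^V) possible lists of moments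
    -- modulo p.
    ... | no ≰ = ⊥-elim (contra (Fin.pigeonhole (ℕ.^-monoʳ-< p (ℕ.nonTrivial⇒n>1 p {{prime⇒nonTrivial pr}}) (ℕ.≰⇒> ≰)) profile))
      where
      weight : Fin (p ℕ.^ K) → Fin K → ℤ
      weight i ℓ = + toℕ (finToFun {p} {K} i ℓ)
      moment : (Fin K → ℤ) → Fin X → (Fin V → ℕ) → Fin K → ℤ
      moment ψ χ e ℓ = restrict chart χ ψ ℓ * (1ℤ * + monomial (λ v → z v ℓ) e)
      exponents : Fin (suc d ℕ.^ V) → Fin V → ℕ
      exponents e v = toℕ (finToFun {suc d} {V} e v)
      momentSum : Fin (p ℕ.^ K) → Fin X × Fin (suc d ℕ.^ V) → ℤ
      momentSum i (χ , e) = sum (moment (weight i) χ (exponents e))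
      momentResidue : Fin (p ℕ.^ K) → Fin (X ℕ.* suc d ℕ.^ V) → Fin p
      momentResidue i x = fromℕ< (ℤ.n%ℕd<d (momentSum i (remQuot (suc d ℕ.^ V) x)) p)
      profile : Fin (p ℕ.^ K) → Fin (p ℕ.^ (X ℕ.* suc d ℕ.^ V))
      profile i = funToFin (momentResidue i)
      congruent : ∀ a b → a ℤ.%ℕ p ≡ b ℤ.%ℕ p → Zero (a - b)
      congruent a b eq = divides (a ℤ./ℕ p - b ℤ./ℕ p) (begin
        a - b ≡⟨ cong₂ _-_ (ℤ.a≡a%ℕn+[a/ℕn]*n a p) (ℤ.a≡a%ℕn+[a/ℕn]*n b p) ⟩
        (+ (a ℤ.%ℕ p) + a ℤ./ℕ p * + p) - (+ (b ℤ.%ℕ p) + b ℤ./ℕ p * + p) ≡⟨ cong (λ u → (+ u + a ℤ./ℕ p * + p) - (+ (b ℤ.%ℕ p) + b ℤ./ℕ p * + p)) eq ⟩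
        (+ (b ℤ.%ℕ p) + a ℤ./ℕ p * + p) - (+ (b ℤ.%ℕ p) + b ℤ./ℕ p * + p) ≡⟨ lem (+ (b ℤ.%ℕ p)) (a ℤ./ℕ p) (b ℤ./ℕ p) (+ p) ⟩
        (a ℤ./ℕ p - b ℤ./ℕ p) * + p ∎)
        where
        open ≡-Reasoning
        lem : ∀ r x y p → (r + x * p) - (r + y * p) ≡ (x - y) * p
        lem = solve-∀
      module _ (i j : Fin (p ℕ.^ K)) (same : profile i ≡ profile j) where
        residues : ∀ x → momentResidue i x ≡ momentResidue j x
        residues x = trans (sym (Fin.finToFun-funToFin (momentResidue i) x)) (trans (cong (λ y → finToFun {p} y x) same) (Fin.finToFun-funToFin (momentResidue j) x))
        moments : ∀ χ e → Zero (sum (moment (weight i) χ (exponents e)) - sum (moment (weight j) χ (exponents e)))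
        moments χ e = subst (λ χe → Zero (momentSum i χe - momentSum j χe)) (Fin.remQuot-combine χ e)
          (congruent (momentSum i _) (momentSum j _)
            (trans (sym (Fin.toℕ-fromℕ< _)) (trans (cong toℕ (residues (combine χ e))) (Fin.toℕ-fromℕ< _))))
        δ : Fin K → ℤ
        δ ℓ = weight i ℓ - weight j ℓ
        kills : ∀ χ e → (∀ v → e v ℕ.≤ d) → Zero (sum (moment δ χ e))
        kills χ e le = Zero-resp (trans (cong₂ (λ a b → a - b) (sum-cong-≗ (eq (weight i))) (sum-cong-≗ (eq (weight j)))) sum-diff) (moments χ code)
          where
          e′ : Fin V → Fin (suc d)
          e′ v = fromℕ< (s≤s (le v))
          code : Fin (suc d ℕ.^ V)
          code = funToFin e′
          exp≡ : ∀ v → exponents code v ≡ e v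
          exp≡ v = trans (cong toℕ (Fin.finToFun-funToFin e′ v)) (Fin.toℕ-fromℕ< _)
          monomial-cong : ∀ {V} (z : Fin V → ℕ) {a b : Fin V → ℕ} → (∀ v → a v ≡ b v) → monomial z a ≡ monomial z b
          monomial-cong {zero} z eq = refl
          monomial-cong {suc V} z eq = cong₂ (λ u v → z zero ℕ.^ u ℕ.* v) (eq zero) (monomial-cong (z ∘ suc) (eq ∘ suc))
          eq : ∀ ψ ℓ → moment ψ χ (exponents code) ℓ ≡ moment ψ χ e ℓ
          eq ψ ℓ = cong (λ u → restrict chart χ ψ ℓ * (1ℤ * + u)) (monomial-cong (λ v → z v ℓ) exp≡)
          lem : ∀ a b m → (a - b) * m + b * m ≡ a * m
          lem = solve-∀
          lem′ : ∀ a b → (a + b) - b ≡ a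
          lem′ = solve-∀
          sum-diff : sum (moment (weight i) χ e) - sum (moment (weight j) χ e) ≡ sum (moment δ χ e)
          sum-diff = trans (cong (_- sum (moment (weight j) χ e)) (trans
              (sum-cong-≗ λ ℓ → sym (trans (cong (λ u → u * (1ℤ * + monomial (λ v → z v ℓ) e) + moment (weight j) χ e ℓ) (restrict-- chart χ (weight i) (weight j) ℓ))
                                           (lem (restrict chart χ (weight i) ℓ) (restrict chart χ (weight j) ℓ) (1ℤ * + monomial (λ v → z v ℓ) e))))
              (∑-distrib-+ (moment δ χ e) (moment (weight j) χ e))))
            (lem′ (sum (moment δ χ e)) (sum (moment (weight j) χ e)))
        separated : ∀ ℓ₀ → finToFun {p} {K} i ℓ₀ ≢ finToFun j ℓ₀ → ⊥
        separated ℓ₀ ne with indicator (restrict chart (chart ℓ₀) δ) ℓ₀ (restrict-supp chart (chart ℓ₀) δ)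
        -- In the sum of ψ·g all terms except that of ℓ₀ vanish modulo p: off the chart through the
        -- restricted weight, on the chart through g. The sum itself vanishes because ψ annihilates
        -- the monomials.
        ... | g , P , nz , zs = ¬Zero-* (δ ℓ₀) (g ℓ₀)
                (λ z → ne (Fin.toℕ-injective (residues-equal _ _ (Fin.toℕ<n _) (Fin.toℕ<n _) z))) nz
                (Zero-resp (trans (sum-single a ℓ₀) (cong (_* g ℓ₀) (restrict-≡ chart δ ℓ₀)))
                  (Zero-sum-cong a a₀ diff
                    (Weights.Poly⇒annihilated p pr K V ψ z (λ ℓ → chart ℓ ≡ chart ℓ₀) (restrict-supp chart (chart ℓ₀) δ) P (kills (chart ℓ₀)))))
          where
          ψ = restrict chart (chart ℓ₀) δ
          a : Fin K → ℤ
          a ℓ = ψ ℓ * g ℓ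
          single : Fin K → (Fin K → ℤ) → Fin K → ℤ
          single ℓ₀ a ℓ with ℓ Fin.≟ ℓ₀
          ... | yes _ = a ℓ
          ... | no _ = 0ℤ
          a₀ = single ℓ₀ a
          diff : ∀ ℓ → Zero (a₀ ℓ - a ℓ)
          diff ℓ with ℓ Fin.≟ ℓ₀
          ... | yes _ = Zero-resp (sym (ℤ.+-inverseʳ (a ℓ))) Zero-0
          ... | no ne with restrict-supp chart (chart ℓ₀) δ ℓ
          ...   | inj₁ eq rewrite eq = Zero-0
          ...   | inj₂ s = Zero-resp (lem (ψ ℓ) (g ℓ)) (∣n⇒∣m*n (- ψ ℓ) (zs ℓ ne s))
            where
            lem : ∀ x y → - x * y ≡ 0ℤ - x * y
            lem = solve-∀
          sum-zero : ∀ {n} (b : Fin n → ℤ) → (∀ i → b i ≡ 0ℤ) → sum b ≡ 0ℤ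
          sum-zero {zero} b eq = refl
          sum-zero {suc n} b eq = cong₂ _+_ (eq zero) (sum-zero (b ∘ suc) (eq ∘ suc))
          pick : ∀ {n} (b : Fin n → ℤ) i → (∀ j → j ≢ i → b j ≡ 0ℤ) → sum b ≡ b i
          pick b zero eq = trans (cong (_+_ (b zero)) (sum-zero (b ∘ suc) λ j → eq (suc j) λ ())) (ℤ.+-identityʳ _)
          pick b (suc i) eq = trans (cong₂ _+_ (eq zero λ ()) (pick (b ∘ suc) i λ j ne → eq (suc j) (ne ∘ Fin.suc-injective))) (ℤ.+-identityˡ _)
          sum-single : ∀ a ℓ₀ → sum (single ℓ₀ a) ≡ a ℓ₀
          sum-single a ℓ₀ = trans (pick (single ℓ₀ a) ℓ₀ off) on
            where
            off : ∀ j → j ≢ ℓ₀ → single ℓ₀ a j ≡ 0ℤ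
            off j ne with j Fin.≟ ℓ₀
            ... | yes eq = contradiction eq ne
            ... | no _ = refl
            on : single ℓ₀ a ℓ₀ ≡ a ℓ₀
            on with ℓ₀ Fin.≟ ℓ₀
            ... | yes _ = refl
            ... | no ne = contradiction refl ne
      contra : (∃[ i ] ∃[ j ] (i Fin.< j × profile i ≡ profile j)) → ⊥
      contra (i , j , i<j , same) with Fin.¬∀⟶∃¬ K (λ ℓ → finToFun {p} {K} i ℓ ≡ finToFun j ℓ) (λ ℓ → _ Fin.≟ _)
                                        (λ all → Fin.<⇒≢ i<j (finToFun-injective {p} {K} all))
      ... | ℓ₀ , ne = separated i j same ℓ₀ ne

  ^-distribʳ-* : ∀ n a b → (a ℕ.* b) ℕ.^ n ≡ a ℕ.^ n ℕ.* b ℕ.^ n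
  ^-distribʳ-* zero a b = refl
  ^-distribʳ-* (suc n) a b = trans (cong (a ℕ.* b ℕ.*_) (^-distribʳ-* n a b)) (lem a b (a ℕ.^ n) (b ℕ.^ n))
    where
    lem : ∀ a b x y → a ℕ.* b ℕ.* (x ℕ.* y) ≡ a ℕ.* x ℕ.* (b ℕ.* y)
    lem = ℕ.solve-∀

  -- The candidate functions and the systems of equations

  module Hash (w c T R D q p : ℕ) .{{_ : ℕ.NonZero q}} .{{_ : ℕ.NonZero p}} where

    Coeffs : Set
    Coeffs = Fin (suc D ℕ.^ (c ℕ.* (T ℕ.* R)))

    coeff : Coeffs → Fin c → Fin T → Fin R → ℤ
    coeff φ j τ i = + toℕ (finToFun {suc D} {c ℕ.* (T ℕ.* R)} φ (combine j (combine τ i)))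

    projection : Fin T → (Fin w → Fin q) → ℤ
    projection τ E = ev (λ i → + toℕ (E i)) (+ toℕ τ)

    total : Coeffs → Fin c → (Fin w → Fin q) → ℤ
    total φ j E = sum (λ τ → ev (coeff φ j τ) (projection τ E))

    residue : Coeffs → Fin c → (Fin w → Fin q) → ℕ
    residue φ j E = total φ j E ℤ.%ℕ p

    hash : Coeffs → (Fin w → Fin q) → Fin c → Fin q
    hash φ E j = fromℕ< (ℕ.m%n<n (residue φ j E) q)

    hash-cong : ∀ φ {E E′} → (∀ i → E i ≡ E′ i) → ∀ j → hash φ E j ≡ hash φ E′ j
    hash-cong φ {E} {E′} eq j = Fin.fromℕ<-cong _ _ (cong (λ x → x ℤ.%ℕ p ℕ.% q) total≡) _ _
      where
      total≡ : total φ j E ≡ total φ j E′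
      total≡ = sum-cong-≗ λ τ → cong (ev (coeff φ j τ)) (ev-cong (+ toℕ τ) (λ i → cong (λ x → + toℕ x) (eq i)))

  look : ∀ {nA n q} → (Fin nA → Fin q) → (Fin n → Fin q) → Fin nA ⊎ Fin n → Fin q
  look A W (inj₁ x) = A x
  look A W (inj₂ x) = W x

  look-cong : ∀ {nA n q} {A A′ : Fin nA → Fin q} {W W′ : Fin n → Fin q} → (∀ x → A x ≡ A′ x) → (∀ x → W x ≡ W′ x) →
    ∀ x → look A W x ≡ look A′ W′ x
  look-cong eqA eqW (inj₁ x) = eqA x
  look-cong eqA eqW (inj₂ x) = eqW x

  -- A system of m equations f(point) = value whose points and values are read off from
  -- nA parameters, shared by all solutions, and n unknowns.
  record System (nA n m w c : ℕ) : Set where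
    field
      point : Fin m → Fin w → Fin nA ⊎ Fin n
      value : Fin m → Fin c → Fin nA ⊎ Fin n

  module _ {nA n m w c : ℕ} {q : ℕ} (f : (Fin w → Fin q) → Fin c → Fin q) where

    -- Disjointness concerns the points, across equations as well as across solutions, because all
    -- of these points together become interpolation nodes.
    record DisjointSolutions (t : ℕ) (Σ₀ : System nA n m w c) (A : Fin nA → Fin q) (W : Fin t → Fin n → Fin q) : Set where
      open System Σ₀
      field
        solves : ∀ k e j → f (look A (W k) ∘ point e) j ≡ look A (W k) (value e j)
        disjoint : ∀ k e k′ e′ → ¬ (k ≡ k′ × e ≡ e′) → ¬ (∀ i → look A (W k) (point e i) ≡ look A (W k′) (point e′ i))

    module _ {t : ℕ} {Σ₀ : System nA n m w c} where
      open System Σ₀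

      disjointSolutions? : ∀ A W → Dec (DisjointSolutions t Σ₀ A W)
      disjointSolutions? A W = map′ (λ { (s , d) → record { solves = s ; disjoint = d } }) (λ D → let open DisjointSolutions D in solves , disjoint)
        (Fin.all? (λ k → Fin.all? λ e → Fin.all? λ j → f (look A (W k) ∘ point e) j Fin.≟ look A (W k) (value e j)) ×-dec
         Fin.all? (λ k → Fin.all? λ e → Fin.all? λ k′ → Fin.all? λ e′ →
           ¬? (k Fin.≟ k′ ×-dec e Fin.≟ e′) →-dec ¬? (Fin.all? λ i → look A (W k) (point e i) Fin.≟ look A (W k′) (point e′ i))))

      disjointSolutions-resp : (∀ {E E′} → (∀ i → E i ≡ E′ i) → ∀ j → f E j ≡ f E′ j) →
        ∀ {A A′ W W′} → (∀ x → A x ≡ A′ x) → (∀ k x → W k x ≡ W′ k x) → DisjointSolutions t Σ₀ A W → DisjointSolutions t Σ₀ A′ W′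
      disjointSolutions-resp f-cong eqA eqW D = record
        { solves = λ k e j → trans (f-cong (λ i → sym (look-cong eqA (eqW k) (point e i))) j)
                               (trans (solves k e j) (look-cong eqA (eqW k) (value e j)))
        ; disjoint = λ k e k′ e′ ne same → disjoint k e k′ e′ ne λ i →
            trans (look-cong eqA (eqW k) (point e i)) (trans (same i) (sym (look-cong eqA (eqW k′) (point e′ i))))
        }
        where open DisjointSolutions D

  -- The counting argument

  module Counting (S nA n m w c r : ℕ) (e₀ : Fin m) (sys : Fin S → System nA n m w c) where

    R T′ T NP V d₀ C₁ X C₂ : ℕ
    R = r ℕ.* m
    T′ = R ℕ.* R ℕ.* w
    T = suc T′
    NP = c ℕ.* (T ℕ.* R)
    V = c ℕ.* (T′ ℕ.* R) ℕ.+ (nA ℕ.+ r ℕ.* n)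
    d₀ = 1 ℕ.+ R ℕ.* 1
    C₁ = suc (interpDegree (λ d → 1 ℕ.+ (d ℕ.+ d)) (λ d → d ℕ.+ (1 ℕ.+ d)) R d₀)
    X = S ℕ.* (T ℕ.* 64 ℕ.^ (R ℕ.* c))
    C₂ = suc ((NP ℕ.+ r) ℕ.* C₁)

    -- The elimination removes c·R = r·(m·c) coefficients, which pays for the r·n unknowns. Only the
    -- `nA` shared parameters remain, and they are counted once, not r times.
    V<NP+r : nA ℕ.< r → n ℕ.≤ m ℕ.* c → V ℕ.< NP ℕ.+ r
    V<NP+r nA<r n≤ = begin-strict
      V                                                        ≡⟨ lem₁ (c ℕ.* (T′ ℕ.* R)) nA (r ℕ.* n) ⟩
      c ℕ.* (T′ ℕ.* R) ℕ.+ r ℕ.* n ℕ.+ nA                       ≤⟨ ℕ.+-monoˡ-≤ nA (ℕ.+-monoʳ-≤ (c ℕ.* (T′ ℕ.* R)) (ℕ.*-monoʳ-≤ r n≤)) ⟩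
      c ℕ.* (T′ ℕ.* R) ℕ.+ r ℕ.* (m ℕ.* c) ℕ.+ nA               ≡⟨ cong (ℕ._+ nA) (lem₂ c T′ r m) ⟩
      NP ℕ.+ nA                                                <⟨ ℕ.+-monoʳ-< NP nA<r ⟩
      NP ℕ.+ r ∎
      where
      open ℕ.≤-Reasoning
      lem₁ : ∀ a b c → a ℕ.+ (b ℕ.+ c) ≡ a ℕ.+ c ℕ.+ b
      lem₁ = ℕ.solve-∀
      lem₂ : ∀ c T r m → c ℕ.* (T ℕ.* (r ℕ.* m)) ℕ.+ r ℕ.* (m ℕ.* c) ≡ c ℕ.* (suc T ℕ.* (r ℕ.* m))
      lem₂ = ℕ.solve-∀

    module _ (D q p : ℕ) .{{q≢0 : ℕ.NonZero q}} .{{p≢0 : ℕ.NonZero p}} (pr : Prime p) (q≤p : q ℕ.≤ p) (p≤64q : p ℕ.≤ 64 ℕ.* q)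
      (T≤q : T ℕ.≤ q) (D<q : D ℕ.< q) where

      open Hash w c T R D q p public
      open Mod p pr

      record Bad (φ : Coeffs) : Set where
        constructor mkBad
        field
          σ : Fin S
          A : Fin nA → Fin q
          -- These are r blocks of D + 1 solutions, so that one choice from each block always yields
          -- r different solutions.
          W : Fin (r ℕ.* suc D) → Fin n → Fin q
          solutions : DisjointSolutions (hash φ) (r ℕ.* suc D) (sys σ) A W
        open DisjointSolutions solutions public

      module Leaves (bad : ∀ φ → Bad φ) where

        K : ℕ
        K = suc D ℕ.^ NP ℕ.* suc D ℕ.^ r

        φ : Fin K → Coeffs
        φ ℓ = proj₁ (remQuot {suc D ℕ.^ NP} (suc D ℕ.^ r) ℓ)

        λcode : Fin K → Fin (suc D ℕ.^ r)
        λcode ℓ = proj₂ (remQuot {suc D ℕ.^ NP} (suc D ℕ.^ r) ℓ)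

        choice : Fin K → Fin r → Fin (suc D)
        choice ℓ = finToFun {suc D} {r} (λcode ℓ)

        module B φ = Bad (bad φ)

        σ : Fin K → Fin S
        σ ℓ = B.σ (φ ℓ)

        A : Fin K → Fin nA → Fin q
        A ℓ = B.A (φ ℓ)

        W : Fin K → Fin r → Fin n → Fin q
        W ℓ i = B.W (φ ℓ) (combine i (choice ℓ i))

        row : Fin R → Fin r
        row k = proj₁ (remQuot {r} (m) k)

        eqn : Fin R → Fin (m)
        eqn k = proj₂ (remQuot {r} (m) k)

        E : Fin K → Fin R → Fin w → Fin q
        E ℓ k x = look (A ℓ) (W ℓ (row k)) (System.point (sys (σ ℓ)) (eqn k) x)

        value : Fin K → Fin R → Fin c → Fin q
        value ℓ k j = look (A ℓ) (W ℓ (row k)) (System.value (sys (σ ℓ)) (eqn k) j)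

        solved : ∀ ℓ k j → hash (φ ℓ) (E ℓ k) j ≡ value ℓ k j
        solved ℓ k j = B.solves (φ ℓ) (combine (row k) (choice ℓ (row k))) (eqn k) j

        E-distinct : ∀ ℓ k k′ → k ≢ k′ → ¬ (∀ x → toℕ (E ℓ k x) ≡ toℕ (E ℓ k′ x))
        E-distinct ℓ k k′ k≢k′ same = B.disjoint (φ ℓ) _ (eqn k) _ (eqn k′)
          (λ { (eq₁ , eq₂) → k≢k′ (trans (sym (Fin.combine-remQuot {r} (m) k))
                 (trans (cong₂ combine (Fin.combine-injectiveˡ (row k) (choice ℓ (row k)) (row k′) (choice ℓ (row k′)) eq₁) eq₂)
                        (Fin.combine-remQuot {r} (m) k′))) })
          (λ x → Fin.toℕ-injective (same x))

        <p : (x : Fin q) → toℕ x ℕ.< p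
        <p x = ℕ.<-≤-trans (Fin.toℕ<n x) q≤p

        separation : ∀ ℓ → ∃[ τ ] (∀ k k′ → k ≢ k′ → ¬ Zero (projection τ (E ℓ k) - projection τ (E ℓ k′)))
        separation ℓ = Separation.separate p pr w R (λ k x → toℕ (E ℓ k x)) (ℕ.≤-trans T≤q q≤p) (λ k x → <p (E ℓ k x)) (E-distinct ℓ)

        τ : Fin K → Fin T
        τ ℓ = proj₁ (separation ℓ)

        ω : Fin K → Fin R → Fin c → Fin 64
        ω ℓ k j = fromℕ< (ℕ.m<n*o⇒m/o<n {residue (φ ℓ) j (E ℓ k)} {64} {q} (ℕ.<-≤-trans (ℤ.n%ℕd<d (total (φ ℓ) j (E ℓ k)) p) p≤64q))

        ωcode : Fin K → Fin (64 ℕ.^ (R ℕ.* c))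
        ωcode ℓ = funToFin (λ x → ω ℓ (proj₁ (remQuot {R} c x)) (proj₂ (remQuot {R} c x)))

        chart : Fin K → Fin X
        chart ℓ = combine (σ ℓ) (combine (τ ℓ) (ωcode ℓ))

        total≈ : ∀ ℓ k j → Zero (total (φ ℓ) j (E ℓ k) - (+ toℕ (value ℓ k j) + + toℕ (ω ℓ k j) * + q))
        total≈ ℓ k j = divides (t ℤ./ℕ p) (begin
          t - (+ toℕ (value ℓ k j) + + toℕ (ω ℓ k j) * + q)
            ≡⟨ cong₂ (λ x y → x - (+ y + + toℕ (ω ℓ k j) * + q)) (ℤ.a≡a%ℕn+[a/ℕn]*n t p) value≡ ⟩
          (+ ρ + t ℤ./ℕ p * + p) - (+ (ρ ℕ.% q) + + toℕ (ω ℓ k j) * + q)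
            ≡⟨ cong (λ y → (+ ρ + t ℤ./ℕ p * + p) - (+ (ρ ℕ.% q) + + y * + q)) ω≡ ⟩
          (+ ρ + t ℤ./ℕ p * + p) - (+ (ρ ℕ.% q) + + (ρ ℕ./ q) * + q)
            ≡⟨ cong (λ y → (+ ρ + t ℤ./ℕ p * + p) - y) (trans (cong (_+_ (+ (ρ ℕ.% q))) (sym (ℤ.pos-* (ρ ℕ./ q) q))) (cong +_ (sym (ℕ.m≡m%n+[m/n]*n ρ q)))) ⟩
          (+ ρ + t ℤ./ℕ p * + p) - + ρ
            ≡⟨ lem (+ ρ) (t ℤ./ℕ p * + p) ⟩
          t ℤ./ℕ p * + p ∎)
          where
          open ≡-Reasoning
          t = total (φ ℓ) j (E ℓ k)
          ρ = residue (φ ℓ) j (E ℓ k)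
          value≡ : toℕ (value ℓ k j) ≡ ρ ℕ.% q
          value≡ = trans (cong toℕ (sym (solved ℓ k j))) (Fin.toℕ-fromℕ< _)
          ω≡ : toℕ (ω ℓ k j) ≡ ρ ℕ./ q
          ω≡ = Fin.toℕ-fromℕ< _
          lem : ∀ x y → (x + y) - x ≡ y
          lem = solve-∀

        Index : Set
        Index = (Fin c × (Fin T′ × Fin R)) ⊎ (Fin nA ⊎ (Fin r × Fin n))

        index↔ : Fin V ↔ Index
        index↔ = (((↔-id _ ×-↔ Fin.*↔×) ↔-∘ Fin.*↔×) ⊎-↔ ((↔-id _ ⊎-↔ Fin.*↔×) ↔-∘ Fin.+↔⊎)) ↔-∘ Fin.+↔⊎

        -- On the chart of ℓ the coefficients belonging to the separating projection τ are
        -- not coordinates: they are rational functions of the remaining ones.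
        coordinate : Index → Fin K → ℕ
        coordinate (inj₁ (j , τ″ , i)) ℓ = toℕ (finToFun {suc D} {NP} (φ ℓ) (combine j (combine (punchIn (τ ℓ) τ″) i)))
        coordinate (inj₂ (inj₁ x)) ℓ = toℕ (A ℓ x)
        coordinate (inj₂ (inj₂ (i , x))) ℓ = toℕ (W ℓ i x)

        z : Fin V → Fin K → ℕ
        z v = coordinate (Inverse.to index↔ v)

        module Indicator (ψ : Fin K → ℤ) (ℓ₀ : Fin K) (supp : ∀ ℓ → ψ ℓ ≡ 0ℤ ⊎ chart ℓ ≡ chart ℓ₀) where

          Supp : Fin K → Set
          Supp ℓ = chart ℓ ≡ chart ℓ₀

          open Weights p pr K V ψ z Supp supp

          σ-const : ∀ ℓ → Supp ℓ → σ ℓ ≡ σ ℓ₀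
          σ-const ℓ s = Fin.combine-injectiveˡ (σ ℓ) (combine (τ ℓ) (ωcode ℓ)) (σ ℓ₀) (combine (τ ℓ₀) (ωcode ℓ₀)) s

          τω-const : ∀ ℓ → Supp ℓ → τ ℓ ≡ τ ℓ₀ × ωcode ℓ ≡ ωcode ℓ₀
          τω-const ℓ s = Fin.combine-injective (τ ℓ) (ωcode ℓ) (τ ℓ₀) (ωcode ℓ₀)
            (Fin.combine-injectiveʳ (σ ℓ) (combine (τ ℓ) (ωcode ℓ)) (σ ℓ₀) (combine (τ ℓ₀) (ωcode ℓ₀)) s)

          ω-const : ∀ ℓ → Supp ℓ → ∀ k j → ω ℓ k j ≡ ω ℓ₀ k j
          ω-const ℓ s k j = subst (λ kj → ω ℓ (proj₁ kj) (proj₂ kj) ≡ ω ℓ₀ (proj₁ kj) (proj₂ kj)) (Fin.remQuot-combine k j)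
            (trans (sym (Fin.finToFun-funToFin (entry ℓ) (combine k j)))
              (trans (cong (λ y → finToFun {64} {R ℕ.* c} y (combine k j)) (proj₂ (τω-const ℓ s)))
                (Fin.finToFun-funToFin (entry ℓ₀) (combine k j))))
            where
            entry : Fin K → Fin (R ℕ.* c) → Fin 64
            entry ℓ x = ω ℓ (proj₁ (remQuot {R} c x)) (proj₂ (remQuot {R} c x))

          τ₀ : Fin T
          τ₀ = τ ℓ₀

          Poly-coordinate : ∀ x → Poly 1 (λ ℓ → + coordinate x ℓ)
          Poly-coordinate x = Poly-≗ (λ ℓ _ → cong (λ y → + coordinate y ℓ) (Inverse.strictlyInverseˡ index↔ x)) (Poly-var (Inverse.from index↔ x))

          Poly-look : ∀ i y → Poly 1 (λ ℓ → + toℕ (look (A ℓ) (W ℓ i) y))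
          Poly-look i (inj₁ x) = Poly-coordinate (inj₂ (inj₁ x))
          Poly-look i (inj₂ x) = Poly-coordinate (inj₂ (inj₂ (i , x)))

          Poly-E : ∀ k x → Poly 1 (λ ℓ → + toℕ (E ℓ k x))
          Poly-E k x = Poly-≗ (λ ℓ s → cong (λ σ → + toℕ (look (A ℓ) (W ℓ (row k)) (System.point (sys σ) (eqn k) x))) (sym (σ-const ℓ s)))
            (Poly-look (row k) (System.point (sys (σ ℓ₀)) (eqn k) x))

          Poly-value : ∀ k j → Poly 1 (λ ℓ → + toℕ (value ℓ k j))
          Poly-value k j = Poly-≗ (λ ℓ s → cong (λ σ → + toℕ (look (A ℓ) (W ℓ (row k)) (System.value (sys σ) (eqn k) j))) (sym (σ-const ℓ s)))
            (Poly-look (row k) (System.value (sys (σ ℓ₀)) (eqn k) j))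

          Poly-projection : ∀ τ k → Poly 1 (λ ℓ → projection τ (E ℓ k))
          Poly-projection τ k = Poly-mono (ℕ.≤-reflexive (cong suc (ℕ.*-zeroʳ w)))
            (Poly-ev (λ i ℓ → + toℕ (E ℓ k i)) (λ _ → + toℕ τ) (Poly-E k) (Poly-const {0} (+ toℕ τ)))

          Poly-coeff : ∀ j τ″ i → Poly 1 (λ ℓ → coeff (φ ℓ) j (punchIn τ₀ τ″) i)
          Poly-coeff j τ″ i = Poly-≗
            (λ ℓ s → cong (λ τ → + toℕ (finToFun {suc D} {NP} (φ ℓ) (combine j (combine (punchIn τ τ″) i)))) (proj₁ (τω-const ℓ s)))
            (Poly-coordinate (inj₁ (j , τ″ , i)))

          summand : Fin c → Fin R → Fin T → Fin K → ℤ
          summand j k τ ℓ = ev (coeff (φ ℓ) j τ) (projection τ (E ℓ k))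

          Poly-other : ∀ j k → Poly d₀ (λ ℓ → sum (λ τ″ → summand j k (punchIn τ₀ τ″) ℓ))
          Poly-other j k = Poly-sum (λ τ″ → summand j k (punchIn τ₀ τ″))
            λ τ″ → Poly-ev (λ i ℓ → coeff (φ ℓ) j (punchIn τ₀ τ″) i) (λ ℓ → projection (punchIn τ₀ τ″) (E ℓ k))
                     (Poly-coeff j τ″) (Poly-projection (punchIn τ₀ τ″) k)

          -- The equation solved for the summand of the separating projection: the value, the fixed
          -- quotient times q and the remaining summands involve only coordinates of the chart.
          Poly-pivot : ∀ j k → Poly d₀ (summand j k τ₀)
          Poly-pivot j k = Poly-cong eq
            (Poly-- (Poly-+ (Poly-mono (s≤s z≤n) (Poly-value k j)) (Poly-const (+ toℕ (ω ℓ₀ k j) * + q))) (Poly-other j k))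
            where
            lem : ∀ a b v → (a + b) - v ≡ a - (v - b)
            lem = solve-∀
            eq : ∀ ℓ → Supp ℓ → Zero (summand j k τ₀ ℓ - ((+ toℕ (value ℓ k j) + + toℕ (ω ℓ₀ k j) * + q) - sum (λ τ″ → summand j k (punchIn τ₀ τ″) ℓ)))
            eq ℓ s = Zero-resp
              (trans (cong₂ (λ x y → x - (+ toℕ (value ℓ k j) + + toℕ y * + q)) (sum-remove {i = τ₀} (λ τ → summand j k τ ℓ)) (ω-const ℓ s k j))
                     (lem (summand j k τ₀ ℓ) (sum (λ τ″ → summand j k (punchIn τ₀ τ″) ℓ)) (+ toℕ (value ℓ k j) + + toℕ (ω ℓ₀ k j) * + q)))
              (total≈ ℓ k j)

          apart : ∀ k k′ → k ≢ k′ → ∀ ℓ → Supp ℓ → ¬ Zero (projection τ₀ (E ℓ k) - projection τ₀ (E ℓ k′))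
          apart k k′ ne ℓ s = subst (λ τ → ¬ Zero (projection τ (E ℓ k) - projection τ (E ℓ k′))) (proj₁ (τω-const ℓ s)) (proj₂ (separation ℓ) k k′ ne)

          -- The R points project to R nodes distinct modulo p, exactly as many as the univariate
          -- polynomial of this projection has coefficients.
          Rat-pivot : ∀ j i → Rat C₁ (λ ℓ → coeff (φ ℓ) j τ₀ i)
          Rat-pivot j i = Rat-mono (ℕ.n≤1+n _) (RatInterpolation.interpolate 1 R d₀ (λ i ℓ → coeff (φ ℓ) j τ₀ i) (λ k ℓ → projection τ₀ (E ℓ k))
            (Poly-projection τ₀) apart (λ k → Poly⇒Rat (Poly-pivot j k)) i)

          Rat-coeff : ∀ j τ i → Dec (τ₀ ≡ τ) → Rat C₁ (λ ℓ → coeff (φ ℓ) j τ i)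
          Rat-coeff j τ i (no ne) = Rat-mono (s≤s z≤n) (Poly⇒Rat
            (subst (λ τ → Poly 1 (λ ℓ → coeff (φ ℓ) j τ i)) (Fin.punchIn-punchOut ne) (Poly-coeff j (punchOut ne) i)))
          Rat-coeff j τ i (yes eq) = subst (λ τ → Rat C₁ (λ ℓ → coeff (φ ℓ) j τ i)) eq (Rat-pivot j i)

          coeffAt : Fin NP → Fin K → Fin (suc D)
          coeffAt x ℓ = finToFun {suc D} {NP} (φ ℓ) x

          Rat-coeffAt : ∀ x → Rat C₁ (λ ℓ → + toℕ (coeffAt x ℓ))
          Rat-coeffAt x =
            let j , y , eq = Fin.combine-surjective {c} {T ℕ.* R} x
                τ , i , eq′ = Fin.combine-surjective {T} {R} y
            in subst (λ x → Rat C₁ (λ ℓ → + toℕ (coeffAt x ℓ))) (trans (cong (combine j) eq′) eq) (Rat-coeff j τ i (τ₀ Fin.≟ τ))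

          rival : Fin r → Fin D → Fin n → Fin q
          rival i v = B.W (φ ℓ₀) (combine i (punchIn (choice ℓ₀ i) v))

          -- Two solutions that agree in all unknowns would share their point in the equation `e₀`,
          -- contrary to disjointness.
          difference : ∀ i v → ∃[ x ] (W ℓ₀ i x ≢ rival i v x)
          difference i v = Fin.¬∀⟶∃¬ n (λ x → W ℓ₀ i x ≡ rival i v x) (λ x → W ℓ₀ i x Fin.≟ rival i v x) λ same →
            B.disjoint (φ ℓ₀) (combine i (choice ℓ₀ i)) e₀ (combine i (punchIn (choice ℓ₀ i) v)) e₀
              (λ { (eq , _) → Fin.punchInᵢ≢i (choice ℓ₀ i) v (sym (Fin.combine-injectiveʳ i (choice ℓ₀ i) i (punchIn (choice ℓ₀ i) v) eq)) })
              (λ x → look-cong (λ _ → refl) same (System.point (sys (σ ℓ₀)) e₀ x))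

          δ : Fin NP → Fin K → ℤ
          δ x = Rat.den (Rat-coeffAt x)

          -- Multiplication by `δ` clears the denominator of the eliminated coefficients. It adds no
          -- zero at ℓ₀, where `δ` is invertible.
          factor₁ : Fin NP → Fin D → Fin K → ℤ
          factor₁ x v ℓ = δ x ℓ * + toℕ (coeffAt x ℓ) - + toℕ (punchIn (coeffAt x ℓ₀) v) * δ x ℓ

          factor₂ : Fin r → Fin D → Fin K → ℤ
          factor₂ i v ℓ = + toℕ (W ℓ i (proj₁ (difference i v))) - + toℕ (rival i v (proj₁ (difference i v)))

          -- The first product vanishes at every point with a different φ. The second then only has
          -- to deal with points having the same φ, where the competing solutions are the rivals,
          -- constants fixed by ℓ₀.
          indicator : Fin K → ℤ
          indicator ℓ = ∏ (λ x → ∏ (λ v → factor₁ x v ℓ)) * ∏ (λ i → ∏ (λ v → factor₂ i v ℓ))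

          Poly-indicator : Poly (NP ℕ.* (D ℕ.* C₁) ℕ.+ r ℕ.* (D ℕ.* C₁)) indicator
          Poly-indicator = Poly-*
            (Poly-∏ (λ x ℓ → ∏ (λ v → factor₁ x v ℓ)) λ x → Poly-∏ (factor₁ x) λ v →
              Poly-- (Rat.num-poly (Rat-coeffAt x)) (Poly-scale (+ toℕ (punchIn (coeffAt x ℓ₀) v)) (Rat.den-poly (Rat-coeffAt x))))
            (Poly-∏ (λ i ℓ → ∏ (λ v → factor₂ i v ℓ)) λ i → Poly-∏ (factor₂ i) λ v →
              Poly-mono (s≤s z≤n) (Poly-- (Poly-coordinate (inj₂ (inj₂ (i , proj₁ (difference i v))))) (Poly-const (+ toℕ (rival i v (proj₁ (difference i v)))))))

          factor₁≡ : ∀ x v ℓ → factor₁ x v ℓ ≡ δ x ℓ * (+ toℕ (coeffAt x ℓ) - + toℕ (punchIn (coeffAt x ℓ₀) v))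
          factor₁≡ x v ℓ = lem (δ x ℓ) (+ toℕ (coeffAt x ℓ)) (+ toℕ (punchIn (coeffAt x ℓ₀) v))
            where
            lem : ∀ d a b → d * a - b * d ≡ d * (a - b)
            lem = solve-∀

          D<p : (x : Fin (suc D)) → toℕ x ℕ.< p
          D<p x = ℕ.<-≤-trans (Fin.toℕ<n x) (ℕ.≤-trans D<q q≤p)

          indicator-nonzero : ¬ Zero (indicator ℓ₀)
          indicator-nonzero = ¬Zero-* (∏ (λ x → ∏ (λ v → factor₁ x v ℓ₀))) (∏ (λ i → ∏ (λ v → factor₂ i v ℓ₀)))
            (¬Zero-∏ (λ x → ∏ (λ v → factor₁ x v ℓ₀)) λ x → ¬Zero-∏ (λ v → factor₁ x v ℓ₀) λ v zero₁ →
              ¬Zero-* (δ x ℓ₀) (+ toℕ (coeffAt x ℓ₀) - + toℕ (punchIn (coeffAt x ℓ₀) v)) (Rat.den-apart (Rat-coeffAt x) ℓ₀ refl)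
                (λ zero₂ → Fin.punchInᵢ≢i (coeffAt x ℓ₀) v (sym (Fin.toℕ-injective (residues-equal _ _ (D<p _) (D<p _) zero₂))))
                (Zero-resp (factor₁≡ x v ℓ₀) zero₁))
            (¬Zero-∏ (λ i → ∏ (λ v → factor₂ i v ℓ₀)) λ i → ¬Zero-∏ (λ v → factor₂ i v ℓ₀) λ v zero₂ →
              proj₂ (difference i v) (Fin.toℕ-injective (residues-equal _ _ (<p _) (<p _) zero₂)))

          Zero-self : ∀ x → Zero (x - x)
          Zero-self x = Zero-resp (sym (ℤ.+-inverseʳ x)) Zero-0

          product₁ product₂ : Fin K → ℤ
          product₁ ℓ = ∏ (λ x → ∏ (λ v → factor₁ x v ℓ))
          product₂ ℓ = ∏ (λ i → ∏ (λ v → factor₂ i v ℓ))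

          zero₁ : ∀ ℓ → (∃[ x ] coeffAt x ℓ₀ ≢ coeffAt x ℓ) → Zero (product₁ ℓ)
          zero₁ ℓ (x , ne) = Zero-∏ (λ x → ∏ (λ v → factor₁ x v ℓ)) x (Zero-∏ (λ v → factor₁ x v ℓ) (punchOut ne)
            (Zero-resp (sym (trans (factor₁≡ x (punchOut ne) ℓ) (cong (λ y → δ x ℓ * (+ toℕ (coeffAt x ℓ) - + toℕ y)) (Fin.punchIn-punchOut ne))))
              (∣n⇒∣m*n (δ x ℓ) (Zero-self (+ toℕ (coeffAt x ℓ))))))

          zero₂ : ∀ ℓ → φ ℓ ≡ φ ℓ₀ → (∃[ i ] choice ℓ₀ i ≢ choice ℓ i) → Zero (product₂ ℓ)
          zero₂ ℓ φ≡ (i , ne) = Zero-∏ (λ i → ∏ (λ v → factor₂ i v ℓ)) i (Zero-∏ (λ v → factor₂ i v ℓ) (punchOut ne)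
            (Zero-resp (cong (λ y → + toℕ y - + toℕ (rival i (punchOut ne) κ)) same) (Zero-self (+ toℕ (rival i (punchOut ne) κ)))))
            where
            κ = proj₁ (difference i (punchOut ne))
            same : rival i (punchOut ne) κ ≡ W ℓ i κ
            same = cong₂ (λ φ v → B.W φ (combine i v) κ) (sym φ≡) (Fin.punchIn-punchOut ne)

          indicator-zero : ∀ ℓ → ℓ ≢ ℓ₀ → Dec (φ ℓ ≡ φ ℓ₀) → Zero (indicator ℓ)
          indicator-zero ℓ ℓ≢ℓ₀ (no φ≢) = ∣m⇒∣m*n (product₂ ℓ) (zero₁ ℓ
            (Fin.¬∀⟶∃¬ NP (λ x → coeffAt x ℓ₀ ≡ coeffAt x ℓ) (λ x → coeffAt x ℓ₀ Fin.≟ coeffAt x ℓ)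
              λ same → φ≢ (finToFun-injective {suc D} {NP} (λ x → sym (same x)))))
          indicator-zero ℓ ℓ≢ℓ₀ (yes φ≡) = ∣n⇒∣m*n (product₁ ℓ) (zero₂ ℓ φ≡
            (Fin.¬∀⟶∃¬ r (λ i → choice ℓ₀ i ≡ choice ℓ i) (λ i → choice ℓ₀ i Fin.≟ choice ℓ i)
              λ same → ℓ≢ℓ₀ (trans (sym (Fin.combine-remQuot {suc D ℕ.^ NP} (suc D ℕ.^ r) ℓ))
                (trans (cong₂ combine φ≡ (finToFun-injective {suc D} {r} (λ i → sym (same i)))) (Fin.combine-remQuot {suc D ℕ.^ NP} (suc D ℕ.^ r) ℓ₀)))))

        leaves-bound : K ℕ.≤ X ℕ.* suc (NP ℕ.* (D ℕ.* C₁) ℕ.+ r ℕ.* (D ℕ.* C₁)) ℕ.^ V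
        leaves-bound = Dimension.bound p pr K X V _ chart z λ ψ ℓ₀ supp →
          let open Indicator ψ ℓ₀ supp in indicator , Poly-indicator , indicator-nonzero , λ ℓ ne _ → indicator-zero ℓ ne (φ ℓ Fin.≟ φ ℓ₀)

      not-all-bad : nA ℕ.< r → n ℕ.≤ m ℕ.* c → X ℕ.* C₂ ℕ.^ V ℕ.≤ D → ¬ (∀ φ → Bad φ)
      not-all-bad nA<r n≤ D-big bad = ℕ.<⇒≱ too-many (Leaves.leaves-bound bad)
        where
        open ℕ.≤-Reasoning
        lem : ∀ N r C D → N ℕ.* (D ℕ.* C) ℕ.+ r ℕ.* (D ℕ.* C) ≡ (N ℕ.+ r) ℕ.* C ℕ.* D
        lem = ℕ.solve-∀
        degree≤ : suc (NP ℕ.* (D ℕ.* C₁) ℕ.+ r ℕ.* (D ℕ.* C₁)) ℕ.≤ C₂ ℕ.* suc D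
        degree≤ = begin
          suc (NP ℕ.* (D ℕ.* C₁) ℕ.+ r ℕ.* (D ℕ.* C₁)) ≡⟨ cong suc (lem NP r C₁ D) ⟩
          suc ((NP ℕ.+ r) ℕ.* C₁ ℕ.* D)                ≤⟨ s≤s (ℕ.≤-trans (ℕ.*-monoʳ-≤ ((NP ℕ.+ r) ℕ.* C₁) (ℕ.n≤1+n D)) (ℕ.m≤n+m _ D)) ⟩
          C₂ ℕ.* suc D                                 ∎
        too-many : X ℕ.* suc (NP ℕ.* (D ℕ.* C₁) ℕ.+ r ℕ.* (D ℕ.* C₁)) ℕ.^ V ℕ.< suc D ℕ.^ NP ℕ.* suc D ℕ.^ r
        too-many = begin-strict
          X ℕ.* suc (NP ℕ.* (D ℕ.* C₁) ℕ.+ r ℕ.* (D ℕ.* C₁)) ℕ.^ V ≤⟨ ℕ.*-monoʳ-≤ X (ℕ.^-monoˡ-≤ V degree≤) ⟩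
          X ℕ.* (C₂ ℕ.* suc D) ℕ.^ V                 ≡⟨ cong (X ℕ.*_) (^-distribʳ-* V C₂ (suc D)) ⟩
          X ℕ.* (C₂ ℕ.^ V ℕ.* suc D ℕ.^ V)           ≡⟨ ℕ.*-assoc X _ _ ⟨
          -- One factor `suc D` absorbs the constant; it is available because V is strictly smaller
          -- than NP + r.
          X ℕ.* C₂ ℕ.^ V ℕ.* suc D ℕ.^ V             <⟨ ℕ.*-monoˡ-< (suc D ℕ.^ V) {{ℕ.m^n≢0 (suc D) V}} (s≤s D-big) ⟩
          suc D ℕ.* suc D ℕ.^ V                      ≤⟨ ℕ.^-monoʳ-≤ (suc D) (V<NP+r nA<r n≤) ⟩
          suc D ℕ.^ (NP ℕ.+ r)                       ≡⟨ ℕ.^-distribˡ-+-* (suc D) NP r ⟩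
          suc D ℕ.^ NP ℕ.* suc D ℕ.^ r               ∎

      Avoiding : Set
      Avoiding = Σ ((Fin w → Fin q) → Fin c → Fin q) λ f →
        (∀ {E E′} → (∀ i → E i ≡ E′ i) → ∀ j → f E j ≡ f E′ j) ×
        (∀ σ A W → ¬ DisjointSolutions f (r ℕ.* suc D) (sys σ) A W)

      private
        -- With parameters and solutions coded as numbers, badness becomes a decidable search over
        -- finite types, so that a good φ can be extracted from the fact that not all are bad.
        Encoded : Coeffs → Set
        Encoded φ = ∃[ σ ] ∃[ a ] ∃[ W ] DisjointSolutions (hash φ) (r ℕ.* suc D) (sys σ)
          (finToFun {q} {nA} a) (λ k → finToFun {q} {n} (finToFun {q ℕ.^ n} {r ℕ.* suc D} W k))

        encode : ∀ {φ} σ A W → DisjointSolutions (hash φ) (r ℕ.* suc D) (sys σ) A W → Encoded φ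
        encode {φ} σ A W sols = σ , funToFin A , funToFin (λ k → funToFin (W k)) ,
          disjointSolutions-resp (hash φ) (hash-cong φ) (λ x → sym (Fin.finToFun-funToFin A x))
            (λ k x → sym (trans (cong (λ y → finToFun {q} {n} y x) (Fin.finToFun-funToFin (λ k → funToFin (W k)) k)) (Fin.finToFun-funToFin (W k) x))) sols

        encoded? : ∀ φ → Dec (Encoded φ)
        encoded? φ = Fin.any? λ σ → Fin.any? λ a → Fin.any? λ W → disjointSolutions? (hash φ) _ _

      avoiding : nA ℕ.< r → n ℕ.≤ m ℕ.* c → X ℕ.* C₂ ℕ.^ V ℕ.≤ D → Avoiding
      avoiding nA<r n≤ D-big =
        let φ , good = Fin.¬∀⟶∃¬ _ Encoded encoded? λ all →
              not-all-bad nA<r n≤ D-big λ φ → let σ , a , W , sols = all φ in mkBad σ _ _ sols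
        in hash φ , hash-cong φ , λ σ A W sols → good (encode σ A W sols)

  FewDisjointSolutions : ∀ {S nA n m w c} → (Fin S → System nA n m w c) → Set
  FewDisjointSolutions {S} {nA} {n} {m} {w} {c} sys =
    ∃[ t₀ ] ∃[ q₀ ] (∀ q → q₀ ℕ.≤ q → Σ ((Fin w → Fin q) → Fin c → Fin q) λ f →
      (∀ {E E′} → (∀ i → E i ≡ E′ i) → ∀ j → f E j ≡ f E′ j) ×
      (∀ σ A W → ¬ DisjointSolutions f t₀ (sys σ) A W))

  few-disjoint-solutions : ∀ {S nA n m w c} (sys : Fin S → System nA n m w c) → Fin m → n ℕ.≤ m ℕ.* c → FewDisjointSolutions sys
  few-disjoint-solutions {S} {nA} {n} {m} {w} {c} sys e₀ n≤ = go (suc nA) (ℕ.n<1+n nA)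
    where
    go : ∀ r → nA ℕ.< r → FewDisjointSolutions sys
    go r nA<r = choose (X ℕ.* C₂ ℕ.^ V) ℕ.≤-refl
      where
      open Counting S nA n m w c r e₀ sys
      choose : ∀ D → X ℕ.* C₂ ℕ.^ V ℕ.≤ D → FewDisjointSolutions sys
      -- The bound on q provides the prime (65), keeps the `T` projection parameters distinct modulo
      -- p, and likewise the coefficients 0, ..., D.
      choose D D-big = r ℕ.* suc D , 65 ℕ.+ (T ℕ.+ suc D) , λ q q₀≤q →
        let p , pr , q≤p , p≤64q = prime-in-[q,64q] q (ℕ.≤-trans (ℕ.m≤m+n 65 _) q₀≤q)
            T+D≤q = ℕ.≤-trans (ℕ.m≤n+m (T ℕ.+ suc D) 65) q₀≤q
        in avoiding D q p {{ℕ.>-nonZero (ℕ.≤-trans (s≤s z≤n) q₀≤q)}} {{prime⇒nonZero pr}} pr q≤p p≤64q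
             (ℕ.≤-trans (ℕ.m≤m+n T (suc D)) T+D≤q) (ℕ.≤-trans (ℕ.m≤n+m (suc D) T) T+D≤q) nA<r n≤ D-big

open PolynomialMethod using (finToFun-injective; look; System; DisjointSolutions; few-disjoint-solutions)

-- The graph

open import Defs
open import Data.Bool using (Bool; true; false; T; not)
import Data.Bool.Properties as Bool
open import Data.Maybe using (Maybe; just; nothing)

-- Counting edges

rank : ∀ {n} (g : Fin n → Bool) (i : Fin n) → T (g i) → Fin (countB g)
rank {suc n} g zero x with g zero
... | true = zero
rank {suc n} g (suc i) x with g zero
... | true = suc (rank (g ∘ suc) i x)
... | false = rank (g ∘ suc) i x

rank-injective : ∀ {n} (g : Fin n → Bool) (i j : Fin n) (x : T (g i)) (y : T (g j)) → rank g i x ≡ rank g j y → i ≡ j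
rank-injective {suc n} g zero zero x y eq = refl
rank-injective {suc n} g zero (suc j) x y eq with g zero
rank-injective {suc n} g zero (suc j) x y () | true
rank-injective {suc n} g (suc i) zero x y eq with g zero
rank-injective {suc n} g (suc i) zero x y () | true
rank-injective {suc n} g (suc i) (suc j) x y eq with g zero
... | true = cong suc (rank-injective (g ∘ suc) i j x y (Fin.suc-injective eq))
... | false = cong suc (rank-injective (g ∘ suc) i j x y eq)

injection⇒≤countB : ∀ {k n} (g : Fin n → Bool) (ι : Fin k → Fin n) → Injective _≡_ _≡_ ι → (∀ i → T (g (ι i))) → k ℕ.≤ countB g
injection⇒≤countB g ι inj on = Fin.injective⇒≤ {f = λ i → rank g (ι i) (on i)}
  λ {i} {j} eq → inj (rank-injective g (ι i) (ι j) (on i) (on j) eq)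

*≤sumFin : ∀ {n} (h : Fin n → ℕ) d → (∀ i → d ℕ.≤ h i) → n ℕ.* d ℕ.≤ sumFin h
*≤sumFin {zero} h d le = z≤n
*≤sumFin {suc n} h d le = ℕ.+-mono-≤ (le zero) (*≤sumFin (h ∘ suc) d (le ∘ suc))

-- The vertex at distance n from aᵢ on the path from aᵢ to bⱼ.
pathVertex : ∀ {s t d} → Fin s → Fin t → ℕ → SubdivV s t d
pathVertex i j zero = branchA i
pathVertex {d = d} i j (suc n) with n ℕ.<? d
... | yes p = internal i j (fromℕ< p)
... | no _ = branchB j

pathV≡pathVertex : ∀ {s t d} (i : Fin s) (j : Fin t) (r : Fin (suc (suc d))) → pathV i j r ≡ pathVertex i j (toℕ r)
pathV≡pathVertex i j zero = refl
pathV≡pathVertex {d = d} i j (suc r) with toℕ r ℕ.<? d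
... | yes p = refl
... | no _ = refl

pathVertex-edge : ∀ {s t d} (i : Fin s) (j : Fin t) n → n ℕ.≤ d → SubdivEdge {s} {t} {d} (pathVertex i j n) (pathVertex i j (suc n))
pathVertex-edge i j n n≤d = i , j , r ,
  trans (pathV≡pathVertex i j (inject₁ r)) (cong (pathVertex i j) (trans (Fin.toℕ-inject₁ r) (Fin.toℕ-fromℕ< (s≤s n≤d)))) ,
  trans (pathV≡pathVertex i j (suc r)) (cong (pathVertex i j ∘ suc) (Fin.toℕ-fromℕ< (s≤s n≤d)))
  where r = fromℕ< (s≤s n≤d)

position : ∀ {s t d} → SubdivV s t d → ℕ
position (branchA _) = 0
position {d = d} (branchB _) = suc d
position (internal _ _ r) = suc (toℕ r)

position-pathVertex : ∀ {s t d} (i : Fin s) (j : Fin t) n → n ℕ.≤ suc d → position {s} {t} {d} (pathVertex i j n) ≡ n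
position-pathVertex i j zero _ = refl
position-pathVertex {d = d} i j (suc n) (s≤s n≤d) with n ℕ.<? d
... | yes p = cong suc (Fin.toℕ-fromℕ< p)
... | no n≮d = cong suc (ℕ.≤-antisym (ℕ.≮⇒≥ n≮d) n≤d)

path : ∀ {s t d} → SubdivV s t d → Maybe (Fin s × Fin t)
path (branchA _) = nothing
path (branchB _) = nothing
path (internal i j _) = just (i , j)

path-pathVertex : ∀ {s t d} (i : Fin s) (j : Fin t) n → n ℕ.< d → path {s} {t} {d} (pathVertex i j (suc n)) ≡ just (i , j)
path-pathVertex {d = d} i j n n<d with n ℕ.<? d
... | yes _ = refl
... | no n≮d = contradiction n<d n≮d

pathVertex-end : ∀ {s t d} (i : Fin s) (j : Fin t) → pathVertex {s} {t} {d} i j (suc d) ≡ branchB j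
pathVertex-end {d = d} i j with d ℕ.<? d
... | yes d<d = contradiction d<d (ℕ.<-irrefl refl)
... | no _ = refl

isLeft : ∀ {m n} → Vtx m n → Bool
isLeft (inj₁ _) = true
isLeft (inj₂ _) = false

Adj⇒opposite : ∀ {m n} (G : BipGraph m n) u v → Adj G u v → isLeft v ≡ not (isLeft u)
Adj⇒opposite G (inj₁ _) (inj₂ _) _ = refl
Adj⇒opposite G (inj₂ _) (inj₁ _) _ = refl

Adj-sym : ∀ {m n} (G : BipGraph m n) u v → Adj G u v → Adj G v u
Adj-sym G (inj₁ _) (inj₂ _) e = e
Adj-sym G (inj₂ _) (inj₁ _) e = e

-- The graph, and the equations satisfied by an embedded subdivision

module Construction (k s a c u : ℕ) (a≤ℓ : a ℕ.≤ c ℕ.+ u) where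

  -- The parameters are the s branch vertices aᵢ. One solution is a vertex bⱼ with its s paths: ℓ
  -- unknowns for bⱼ, a + ℓ for each of the k pairs of internal vertices on a path, and one equation
  -- for each of the s·(2k+1) edges. Branch vertices get ℓ places on either side, so that both
  -- orientations fit one format.
  ℓ nA n m w : ℕ
  ℓ = c ℕ.+ u
  nA = s ℕ.* ℓ
  n = ℓ ℕ.+ s ℕ.* (k ℕ.* (a ℕ.+ ℓ))
  m = s ℕ.* (suc k ℕ.+ k)
  w = a ℕ.+ u

  -- The vertices at even distance from aᵢ and those at odd distance are both numbered
  -- from 0 to k. The edges are {2κ, 2κ+1} for κ ≤ k and {2κ+1, 2κ+2} for κ < k.
  Edge : Set
  Edge = Fin (suc k) ⊎ Fin k

  evenEnd oddEnd : Edge → Fin (suc k)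
  evenEnd (inj₁ κ) = κ
  evenEnd (inj₂ κ) = suc κ
  oddEnd (inj₁ κ) = κ
  oddEnd (inj₂ κ) = inject₁ κ

  aRef : Fin s → Fin ℓ → Fin nA ⊎ Fin n
  aRef i x = inj₁ (combine i x)

  bRef : Fin ℓ → Fin nA ⊎ Fin n
  bRef x = inj₂ (x ↑ˡ (s ℕ.* (k ℕ.* (a ℕ.+ ℓ))))

  -- The 2κ+1-st and 2κ+2-nd vertices of a path share a block of a + ℓ unknowns, in
  -- which the vertex in M comes first.
  blockRef : Fin s → Fin k → Fin (a ℕ.+ ℓ) → Fin nA ⊎ Fin n
  blockRef i κ z = inj₂ (ℓ ↑ʳ combine i (combine κ z))

  evenRef : ∀ {b} → (Fin b → Fin ℓ) → (Fin b → Fin (a ℕ.+ ℓ)) → Fin s → Fin (suc k) → Fin b → Fin nA ⊎ Fin n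
  evenRef pad inner i zero x = aRef i (pad x)
  evenRef pad inner i (suc κ) x = blockRef i κ (inner x)

  oddRef : ∀ {b} → (Fin b → Fin ℓ) → (Fin b → Fin (a ℕ.+ ℓ)) → Fin s → Fin (suc k) → Fin b → Fin nA ⊎ Fin n
  oddRef pad inner i κ x with toℕ κ ℕ.<? k
  ... | yes κ<k = blockRef i (fromℕ< κ<k) (inner x)
  ... | no _ = bRef (pad x)

  padM : Fin a → Fin ℓ
  padM x = inject≤ x a≤ℓ

  -- In system 0 the vertices aᵢ lie in M, in system 1 they lie in N.
  refM : Fin 2 → Fin s → Edge → Fin a → Fin nA ⊎ Fin n
  refM zero i e = evenRef padM (_↑ˡ ℓ) i (evenEnd e)
  refM (suc zero) i e = oddRef padM (_↑ˡ ℓ) i (oddEnd e)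

  refN : Fin 2 → Fin s → Edge → Fin ℓ → Fin nA ⊎ Fin n
  refN zero i e = oddRef id (a ↑ʳ_) i (oddEnd e)
  refN (suc zero) i e = evenRef id (a ↑ʳ_) i (evenEnd e)

  edgeOf : Fin m → Fin s × Edge
  edgeOf e = let i , y = remQuot {s} (suc k ℕ.+ k) e in i , splitAt (suc k) y

  edgeOf-injective : ∀ e e′ → edgeOf e ≡ edgeOf e′ → e ≡ e′
  edgeOf-injective e e′ eq = trans (sym (Fin.combine-remQuot {s} (suc k ℕ.+ k) e))
    (trans (cong₂ combine (cong proj₁ eq) (trans (sym (Fin.join-splitAt (suc k) k _)) (trans (cong (Fin.join (suc k) k ∘ proj₂) eq) (Fin.join-splitAt (suc k) k _))))
      (Fin.combine-remQuot {s} (suc k ℕ.+ k) e′))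

  sys : Fin 2 → System nA n m w c
  sys σ = record
    { point = λ e z → [ refM σ (proj₁ (edgeOf e)) (proj₂ (edgeOf e)) , (λ y → refN σ (proj₁ (edgeOf e)) (proj₂ (edgeOf e)) (c ↑ʳ y)) ]′ (splitAt a z)
    ; value = λ e j → refN σ (proj₁ (edgeOf e)) (proj₂ (edgeOf e)) (j ↑ˡ u)
    }

  module _ {q : ℕ} (f : (Fin w → Fin q) → Fin c → Fin q) (f-cong : ∀ {E E′} → (∀ i → E i ≡ E′ i) → ∀ j → f E j ≡ f E′ j) where

    pointOf : (Fin a → Fin q) → (Fin ℓ → Fin q) → Fin w → Fin q
    pointOf x y z = [ x , (λ v → y (c ↑ʳ v)) ]′ (splitAt a z)

    graph : BipGraph (q ℕ.^ a) (q ℕ.^ ℓ)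
    graph x y = ⌊ Fin.all? (λ j → finToFun {q} {ℓ} y (j ↑ˡ u) Fin.≟ f (pointOf (finToFun {q} {a} x) (finToFun {q} {ℓ} y)) j) ⌋

    -- Each string v of u digits extends to a neighbour (f(x , v) , v) of x.
    edges≥ : q ℕ.^ a ℕ.* q ℕ.^ u ℕ.≤ edges graph
    edges≥ = *≤sumFin (λ x → countB (graph x)) (q ℕ.^ u) λ x →
      injection⇒≤countB (graph x) (neighbour x) (λ {v} {v′} → neighbour-injective x v v′) (neighbour-adj x)
      where
      digits : Fin (q ℕ.^ a) → Fin (q ℕ.^ u) → Fin ℓ → Fin q
      digits x v y = [ f (λ z → [ finToFun {q} {a} x , finToFun {q} {u} v ]′ (splitAt a z)) , finToFun {q} {u} v ]′ (splitAt c y)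
      neighbour : Fin (q ℕ.^ a) → Fin (q ℕ.^ u) → Fin (q ℕ.^ ℓ)
      neighbour x v = funToFin (digits x v)
      right : ∀ x v i → finToFun {q} {ℓ} (neighbour x v) (c ↑ʳ i) ≡ finToFun {q} {u} v i
      right x v i = trans (Fin.finToFun-funToFin (digits x v) (c ↑ʳ i)) (cong [ _ , _ ]′ (Fin.splitAt-↑ʳ c u i))
      left : ∀ x v j → finToFun {q} {ℓ} (neighbour x v) (j ↑ˡ u) ≡ f (λ z → [ finToFun {q} {a} x , finToFun {q} {u} v ]′ (splitAt a z)) j
      left x v j = trans (Fin.finToFun-funToFin (digits x v) (j ↑ˡ u)) (cong [ _ , _ ]′ (Fin.splitAt-↑ˡ c j u))
      neighbour-injective : ∀ x v v′ → neighbour x v ≡ neighbour x v′ → v ≡ v′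
      neighbour-injective x v v′ eq = finToFun-injective {q} {u} λ i →
        trans (sym (right x v i)) (trans (cong (λ y → finToFun {q} {ℓ} y (c ↑ʳ i)) eq) (right x v′ i))
      same : ∀ x v z → [ finToFun {q} {a} x , finToFun {q} {u} v ]′ (splitAt a z) ≡ pointOf (finToFun {q} {a} x) (finToFun {q} {ℓ} (neighbour x v)) z
      same x v z with splitAt a z
      ... | inj₁ _ = refl
      ... | inj₂ i = sym (right x v i)
      neighbour-adj : ∀ x v → T (graph x (neighbour x v))
      neighbour-adj x v = fromWitness λ j → trans (left x v j) (f-cong (same x v) j)

    module Embedded {t : ℕ} (o : Fin q) (1≤k : 1 ℕ.≤ k) (h : SubdivV s t (2 ℕ.* k) → Vtx (q ℕ.^ a) (q ℕ.^ ℓ)) (h-inj : Injective _≡_ _≡_ h)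
      (h-adj : ∀ u v → SubdivEdge u v → Adj graph (h u) (h v)) where

      digM : Vtx (q ℕ.^ a) (q ℕ.^ ℓ) → Fin a → Fin q
      digM (inj₁ x) = finToFun {q} {a} x
      digM (inj₂ _) _ = o

      digN : Vtx (q ℕ.^ a) (q ℕ.^ ℓ) → Fin ℓ → Fin q
      digN (inj₁ _) _ = o
      digN (inj₂ y) = finToFun {q} {ℓ} y

      truncate : (Fin a → Fin q) → Fin ℓ → Fin q
      truncate x y with toℕ y ℕ.<? a
      ... | yes y<a = x (fromℕ< y<a)
      ... | no _ = o

      truncate-padM : ∀ x i → truncate x (padM i) ≡ x i
      truncate-padM x i with toℕ (padM i) ℕ.<? a
      ... | yes y<a = cong x (Fin.toℕ-injective (trans (Fin.toℕ-fromℕ< y<a) (Fin.toℕ-inject≤ i a≤ℓ)))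
      ... | no y≮a = contradiction (subst (ℕ._< a) (sym (Fin.toℕ-inject≤ i a≤ℓ)) (Fin.toℕ<n i)) y≮a

      -- A branch vertex in M has only a digits; the filler `o` occupies the rest of its ℓ places.
      dig : Vtx (q ℕ.^ a) (q ℕ.^ ℓ) → Fin ℓ → Fin q
      dig (inj₁ x) = truncate (finToFun {q} {a} x)
      dig (inj₂ y) = finToFun {q} {ℓ} y

      dig-M : ∀ v → isLeft v ≡ true → ∀ x → dig v (padM x) ≡ digM v x
      dig-M (inj₁ v) _ x = truncate-padM (finToFun {q} {a} v) x

      dig-N : ∀ v → isLeft v ≡ false → ∀ x → dig v x ≡ digN v x
      dig-N (inj₂ v) _ x = refl

      evenV oddV : Fin s → Fin t → Fin (suc k) → SubdivV s t (2 ℕ.* k)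
      evenV i j κ = pathVertex i j (toℕ κ ℕ.+ toℕ κ)
      oddV i j κ = pathVertex i j (suc (toℕ κ ℕ.+ toℕ κ))

      double≤ : ∀ {κ} → κ ℕ.≤ k → κ ℕ.+ κ ℕ.≤ 2 ℕ.* k
      double≤ {κ} κ≤k = ℕ.+-mono-≤ κ≤k (subst (κ ℕ.≤_) (sym (ℕ.+-identityʳ k)) κ≤k)

      2+double≤ : ∀ {κ} → κ ℕ.< k → suc (suc (κ ℕ.+ κ)) ℕ.≤ 2 ℕ.* k
      2+double≤ {κ} κ<k = subst (ℕ._≤ 2 ℕ.* k) (cong suc (ℕ.+-suc κ κ)) (double≤ κ<k)

      κ≤k : (κ : Fin (suc k)) → toℕ κ ℕ.≤ k
      κ≤k κ = ℕ.≤-pred (Fin.toℕ<n κ)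

      edge-adj : ∀ i j e → Adj graph (h (evenV i j (evenEnd e))) (h (oddV i j (oddEnd e)))
      edge-adj i j (inj₁ κ) = h-adj _ _ (pathVertex-edge i j _ (double≤ (κ≤k κ)))
      edge-adj i j (inj₂ κ) = subst₂ (λ x y → Adj graph (h (pathVertex i j x)) (h (pathVertex i j y)))
        (cong suc (sym (ℕ.+-suc (toℕ κ) (toℕ κ)))) (cong (λ x → suc (x ℕ.+ x)) (sym (Fin.toℕ-inject₁ κ)))
        (Adj-sym graph (h (pathVertex i j (suc (toℕ κ ℕ.+ toℕ κ)))) (h (pathVertex i j (suc (suc (toℕ κ ℕ.+ toℕ κ)))))
          (h-adj _ _ (pathVertex-edge i j _ (ℕ.≤-trans (ℕ.n≤1+n _) (2+double≤ (Fin.toℕ<n κ))))))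

      side : Fin s → Fin t → ℕ → Bool
      side i j n = isLeft (h (pathVertex i j n))

      side-suc : ∀ i j n → n ℕ.≤ 2 ℕ.* k → side i j (suc n) ≡ not (side i j n)
      side-suc i j n n≤ = Adj⇒opposite graph _ _ (h-adj _ _ (pathVertex-edge i j n n≤))

      side-even : ∀ i j κ → κ ℕ.≤ k → side i j (κ ℕ.+ κ) ≡ isLeft (h (branchA i))
      side-even i j zero _ = refl
      side-even i j (suc κ) κ<k rewrite ℕ.+-suc κ κ = begin
        side i j (suc (suc (κ ℕ.+ κ)))  ≡⟨ side-suc i j _ (ℕ.≤-trans (ℕ.n≤1+n _) (2+double≤ κ<k)) ⟩
        not (side i j (suc (κ ℕ.+ κ)))  ≡⟨ cong not (side-suc i j _ (double≤ (ℕ.<⇒≤ κ<k))) ⟩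
        not (not (side i j (κ ℕ.+ κ)))  ≡⟨ Bool.not-involutive _ ⟩
        side i j (κ ℕ.+ κ)              ≡⟨ side-even i j κ (ℕ.<⇒≤ κ<k) ⟩
        isLeft (h (branchA i))          ∎
        where open ≡-Reasoning

      side-odd : ∀ i j κ → κ ℕ.≤ k → side i j (suc (κ ℕ.+ κ)) ≡ not (isLeft (h (branchA i)))
      side-odd i j κ κ≤ = trans (side-suc i j _ (double≤ κ≤)) (cong not (side-even i j κ κ≤))

      side-B : ∀ i j → isLeft (h (branchB j)) ≡ not (isLeft (h (branchA i)))
      side-B i j = trans (cong (isLeft ∘ h) (sym (trans (cong (pathVertex i j ∘ suc) k+k≡) (pathVertex-end i j)))) (side-odd i j k ℕ.≤-refl)
        where
        k+k≡ : k ℕ.+ k ≡ 2 ℕ.* k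
        k+k≡ = cong (k ℕ.+_) (sym (ℕ.+-identityʳ k))

      -- Positions along the path determine the edge number. The path itself is read off from an end
      -- that is internal, since branch vertices are shared by several paths. For the edge at aᵢ
      -- that end is the vertex at distance 1, which is internal because k ≥ 1.
      same-edge : ∀ i j e i′ j′ e′ → evenV i j (evenEnd e) ≡ evenV i′ j′ (evenEnd e′) → oddV i j (oddEnd e) ≡ oddV i′ j′ (oddEnd e′) →
        j ≡ j′ × (i , e) ≡ (i′ , e′)
      same-edge i j e i′ j′ e′ eq₀ eq₁ = finish e e′ (index-eq (ends e) (ends e′)) eq₀ eq₁
        where
        double-injective : ∀ x y → x ℕ.+ x ≡ y ℕ.+ y → x ≡ y
        double-injective zero zero _ = refl
        double-injective (suc x) (suc y) eq rewrite ℕ.+-suc x x | ℕ.+-suc y y =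
          cong suc (double-injective x y (ℕ.suc-injective (ℕ.suc-injective eq)))
        even≡ : evenEnd e ≡ evenEnd e′
        even≡ = Fin.toℕ-injective (double-injective _ _
          (trans (sym (position-pathVertex i j _ (ℕ.m≤n⇒m≤1+n (double≤ (κ≤k (evenEnd e))))))
            (trans (cong position eq₀) (position-pathVertex i′ j′ _ (ℕ.m≤n⇒m≤1+n (double≤ (κ≤k (evenEnd e′))))))))
        odd≡ : oddEnd e ≡ oddEnd e′
        odd≡ = Fin.toℕ-injective (double-injective _ _ (ℕ.suc-injective
          (trans (sym (position-pathVertex i j _ (s≤s (double≤ (κ≤k (oddEnd e))))))
            (trans (cong position eq₁) (position-pathVertex i′ j′ _ (s≤s (double≤ (κ≤k (oddEnd e′)))))))))
        ends : ∀ e → (Σ _ λ κ → e ≡ inj₁ κ) ⊎ (Σ _ λ κ → e ≡ inj₂ κ)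
        ends (inj₁ κ) = inj₁ (κ , refl)
        ends (inj₂ κ) = inj₂ (κ , refl)
        index-eq : _ → _ → e ≡ e′
        index-eq (inj₁ (κ , refl)) (inj₁ (κ′ , refl)) = cong inj₁ even≡
        index-eq (inj₂ (κ , refl)) (inj₂ (κ′ , refl)) = cong inj₂ (Fin.suc-injective even≡)
        index-eq (inj₁ (κ , refl)) (inj₂ (κ′ , refl)) =
          contradiction (trans (sym (cong toℕ even≡)) (trans (cong toℕ odd≡) (Fin.toℕ-inject₁ κ′))) ℕ.1+n≢n
        index-eq (inj₂ (κ , refl)) (inj₁ (κ′ , refl)) =
          contradiction (trans (cong toℕ even≡) (trans (sym (cong toℕ odd≡)) (Fin.toℕ-inject₁ κ))) ℕ.1+n≢n
        on-path : ∀ n → n ℕ.< 2 ℕ.* k → pathVertex {s} {t} {2 ℕ.* k} i j (suc n) ≡ pathVertex i′ j′ (suc n) → i ≡ i′ × j ≡ j′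
        on-path n n< eq with trans (sym (path-pathVertex i j n n<)) (trans (cong path eq) (path-pathVertex i′ j′ n n<))
        ... | refl = refl , refl
        finish : ∀ e e′ → e ≡ e′ → evenV i j (evenEnd e) ≡ evenV i′ j′ (evenEnd e′) → oddV i j (oddEnd e) ≡ oddV i′ j′ (oddEnd e′) →
          j ≡ j′ × (i , e) ≡ (i′ , e′)
        finish (inj₁ zero) _ refl eq₀ eq₁ with on-path 0 (ℕ.≤-trans 1≤k (ℕ.m≤m+n k _)) eq₁
        ... | refl , refl = refl , refl
        finish (inj₁ (suc κ)) _ refl eq₀ eq₁ with on-path (toℕ κ ℕ.+ suc (toℕ κ)) (double≤ (κ≤k (suc κ))) eq₀
        ... | refl , refl = refl , refl
        finish (inj₂ κ) _ refl eq₀ eq₁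
          with on-path (toℕ (inject₁ κ) ℕ.+ toℕ (inject₁ κ))
                 (subst (λ x → x ℕ.+ x ℕ.< 2 ℕ.* k) (sym (Fin.toℕ-inject₁ κ)) (ℕ.≤-trans (ℕ.n≤1+n _) (2+double≤ (Fin.toℕ<n κ)))) eq₁
        ... | refl , refl = refl , refl

      adj-value : ∀ v v′ → isLeft v ≡ true → Adj graph v v′ → ∀ j → digN v′ (j ↑ˡ u) ≡ f (pointOf (digM v) (digN v′)) j
      adj-value (inj₁ x) (inj₂ y) _ adj = toWitness adj

      -- The c digits of the N-end that are missing from the point equal f of the point by
      -- adjacency, so the point determines the whole edge. In this way injectivity of the embedding
      -- becomes disjointness of points.
      vertex-eq : ∀ v v′ x x′ → isLeft v ≡ true → isLeft x ≡ true → Adj graph v v′ → Adj graph x x′ →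
        (∀ z → pointOf (digM v) (digN v′) z ≡ pointOf (digM x) (digN x′) z) → v ≡ x × v′ ≡ x′
      vertex-eq v@(inj₁ v₀) v′@(inj₂ v₁) x@(inj₁ x₀) x′@(inj₂ x₁) _ _ adj adj′ same =
        cong inj₁ (finToFun-injective {q} {a} λ i → trans (sym (cong [ _ , _ ]′ (Fin.splitAt-↑ˡ a i u)))
          (trans (same (i ↑ˡ u)) (cong [ _ , _ ]′ (Fin.splitAt-↑ˡ a i u)))) ,
        cong inj₂ (finToFun-injective {q} {ℓ} λ y → subst (λ y → finToFun {q} {ℓ} v₁ y ≡ finToFun {q} {ℓ} x₁ y) (Fin.join-splitAt c u y) (digit (splitAt c y)))
        where
        digit : ∀ y → finToFun {q} {ℓ} v₁ (Fin.join c u y) ≡ finToFun {q} {ℓ} x₁ (Fin.join c u y)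
        digit (inj₁ j) = trans (adj-value v v′ refl adj j) (trans (f-cong same j) (sym (adj-value x x′ refl adj′ j)))
        digit (inj₂ i) = trans (sym (cong [ _ , _ ]′ (Fin.splitAt-↑ʳ a u i))) (trans (same (a ↑ʳ i)) (cong [ _ , _ ]′ (Fin.splitAt-↑ʳ a u i)))

      A : Fin nA → Fin q
      A x = dig (h (branchA (proj₁ (remQuot {s} ℓ x)))) (proj₂ (remQuot {s} ℓ x))

      A-at : ∀ i x → A (combine i x) ≡ dig (h (branchA i)) x
      A-at i x = cong (λ ix → dig (h (branchA (proj₁ ix))) (proj₂ ix)) (Fin.remQuot-combine i x)

      -- `first` and `second` name the vertices of a block by side, M and then N, and not by their
      -- order on the path.
      module Unknowns (first second : Fin s → Fin t → Fin k → SubdivV s t (2 ℕ.* k)) where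

        block : Fin t → Fin s → Fin k → Fin (a ℕ.+ ℓ) → Fin q
        block j i κ z = [ digM (h (first i j κ)) , digN (h (second i j κ)) ]′ (splitAt a z)

        W : Fin t → Fin n → Fin q
        W j x = [ dig (h (branchB j)) , (λ y → block j (proj₁ (remQuot {s} (k ℕ.* (a ℕ.+ ℓ)) y))
                    (proj₁ (remQuot {k} (a ℕ.+ ℓ) (proj₂ (remQuot {s} (k ℕ.* (a ℕ.+ ℓ)) y))))
                    (proj₂ (remQuot {k} (a ℕ.+ ℓ) (proj₂ (remQuot {s} (k ℕ.* (a ℕ.+ ℓ)) y))))) ]′ (splitAt ℓ x)

        look-a : ∀ j i x → look A (W j) (aRef i x) ≡ dig (h (branchA i)) x
        look-a j i x = A-at i x

        look-b : ∀ j x → look A (W j) (bRef x) ≡ dig (h (branchB j)) x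
        look-b j x = cong [ _ , _ ]′ (Fin.splitAt-↑ˡ ℓ x (s ℕ.* (k ℕ.* (a ℕ.+ ℓ))))

        look-block : ∀ j i κ z → look A (W j) (blockRef i κ z) ≡ block j i κ z
        look-block j i κ z = trans (cong [ _ , _ ]′ (Fin.splitAt-↑ʳ ℓ (s ℕ.* (k ℕ.* (a ℕ.+ ℓ))) (combine i (combine κ z))))
          (trans (cong (λ iy → block j (proj₁ iy) (proj₁ (remQuot {k} (a ℕ.+ ℓ) (proj₂ iy))) (proj₂ (remQuot {k} (a ℕ.+ ℓ) (proj₂ iy))))
              (Fin.remQuot-combine i (combine κ z)))
            (cong (λ κz → block j i (proj₁ κz) (proj₂ κz)) (Fin.remQuot-combine κ z)))

        look-M : ∀ j i κ x → look A (W j) (blockRef i κ (x ↑ˡ ℓ)) ≡ digM (h (first i j κ)) x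
        look-M j i κ x = trans (look-block j i κ (x ↑ˡ ℓ)) (cong [ _ , _ ]′ (Fin.splitAt-↑ˡ a x ℓ))

        look-N : ∀ j i κ x → look A (W j) (blockRef i κ (a ↑ʳ x)) ≡ digN (h (second i j κ)) x
        look-N j i κ x = trans (look-block j i κ (a ↑ʳ x)) (cong [ _ , _ ]′ (Fin.splitAt-↑ʳ a ℓ x))

        look-even : ∀ {b} (pad : Fin b → Fin ℓ) inner (D : Vtx (q ℕ.^ a) (q ℕ.^ ℓ) → Fin b → Fin q) i j κ →
          (∀ x → dig (h (branchA i)) (pad x) ≡ D (h (branchA i)) x) →
          (∀ κ x → look A (W j) (blockRef i κ (inner x)) ≡ D (h (evenV i j (suc κ))) x) →
          ∀ x → look A (W j) (evenRef pad inner i κ x) ≡ D (h (evenV i j κ)) x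
        look-even pad inner D i j zero eqA eqB x = trans (look-a j i (pad x)) (eqA x)
        look-even pad inner D i j (suc κ) eqA eqB x = eqB κ x

        look-odd : ∀ {b} (pad : Fin b → Fin ℓ) inner (D : Vtx (q ℕ.^ a) (q ℕ.^ ℓ) → Fin b → Fin q) i j κ →
          (∀ x → dig (h (branchB j)) (pad x) ≡ D (h (branchB j)) x) →
          (∀ κ x → look A (W j) (blockRef i κ (inner x)) ≡ D (h (oddV i j (inject₁ κ))) x) →
          ∀ x → look A (W j) (oddRef pad inner i κ x) ≡ D (h (oddV i j κ)) x
        look-odd pad inner D i j κ eqB eqI x with toℕ κ ℕ.<? k
        ... | yes κ<k = trans (eqI (fromℕ< κ<k) x)
                (cong (λ κ → D (h (oddV i j κ)) x) (Fin.toℕ-injective (trans (Fin.toℕ-inject₁ (fromℕ< κ<k)) (Fin.toℕ-fromℕ< κ<k))))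
        ... | no κ≮k = trans (look-b j (pad x)) (trans (eqB x) (cong (λ v → D (h v) x) (sym (trans (cong (pathVertex i j ∘ suc) κ+κ≡) (pathVertex-end i j)))))
          where
          κ≡k : toℕ κ ≡ k
          κ≡k = ℕ.≤-antisym (κ≤k κ) (ℕ.≮⇒≥ κ≮k)
          κ+κ≡ : toℕ κ ℕ.+ toℕ κ ≡ 2 ℕ.* k
          κ+κ≡ = trans (cong₂ ℕ._+_ κ≡k κ≡k) (cong (k ℕ.+_) (sym (ℕ.+-identityʳ k)))

      -- `mv` and `nv` give the end of each edge in M and in N, so that one argument covers both
      -- orientations of the subdivision.
      disjointSolutions : ∀ σ (W : Fin t → Fin n → Fin q) (mv nv : Fin s → Fin t → Edge → SubdivV s t (2 ℕ.* k)) →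
        (∀ i j e x → look A (W j) (refM σ i e x) ≡ digM (h (mv i j e)) x) →
        (∀ i j e x → look A (W j) (refN σ i e x) ≡ digN (h (nv i j e)) x) →
        (∀ i j e → isLeft (h (mv i j e)) ≡ true) →
        (∀ i j e → Adj graph (h (mv i j e)) (h (nv i j e))) →
        (∀ i j e i′ j′ e′ → mv i j e ≡ mv i′ j′ e′ → nv i j e ≡ nv i′ j′ e′ → j ≡ j′ × (i , e) ≡ (i′ , e′)) →
        DisjointSolutions f t (sys σ) A W
      disjointSolutions σ W mv nv eqM eqN left adj unique = record
        { solves = λ j e y → let i , e = edgeOf e in
            trans (f-cong (point≡ j i e) y) (trans (sym (adj-value _ _ (left i j e) (adj i j e) y)) (sym (eqN i j e (y ↑ˡ u))))
        ; disjoint = λ j e j′ e′ ne same → let i , e₁ = edgeOf e ; i′ , e₂ = edgeOf e′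
                                               v , v′ = vertex-eq _ _ _ _ (left i j e₁) (left i′ j′ e₂) (adj i j e₁) (adj i′ j′ e₂)
                                                         (λ z → trans (sym (point≡ j i e₁ z)) (trans (same z) (point≡ j′ i′ e₂ z)))
                                               j≡ , e≡ = unique i j e₁ i′ j′ e₂ (h-inj v) (h-inj v′)
                                           in ne (j≡ , edgeOf-injective e e′ e≡)
        }
        where
        point≡ : ∀ j i e z → look A (W j) ([ refM σ i e , (λ y → refN σ i e (c ↑ʳ y)) ]′ (splitAt a z)) ≡ pointOf (digM (h (mv i j e))) (digN (h (nv i j e))) z
        point≡ j i e z with splitAt a z
        ... | inj₁ x = eqM i j e x
        ... | inj₂ y = eqN i j e (c ↑ʳ y)

      evenInner oddInner : Fin s → Fin t → Fin k → SubdivV s t (2 ℕ.* k)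
      evenInner i j κ = evenV i j (suc κ)
      oddInner i j κ = oddV i j (inject₁ κ)

      solutions-A⊆M : (∀ i → isLeft (h (branchA i)) ≡ true) → (∀ j → isLeft (h (branchB j)) ≡ false) →
        ∃[ W ] DisjointSolutions f t (sys zero) A W
      solutions-A⊆M leftA rightB = W , disjointSolutions zero W (λ i j e → evenV i j (evenEnd e)) (λ i j e → oddV i j (oddEnd e))
        (λ i j e → look-even padM (_↑ˡ ℓ) digM i j (evenEnd e) (dig-M _ (leftA i)) (look-M j i))
        (λ i j e → look-odd id (a ↑ʳ_) digN i j (oddEnd e) (dig-N _ (rightB j)) (look-N j i))
        (λ i j e → trans (side-even i j _ (κ≤k (evenEnd e))) (leftA i))
        edge-adj same-edge
        where open Unknowns evenInner oddInner

      solutions-A⊆N : (∀ i → isLeft (h (branchA i)) ≡ false) → (∀ j → isLeft (h (branchB j)) ≡ true) →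
        ∃[ W ] DisjointSolutions f t (sys (suc zero)) A W
      solutions-A⊆N rightA leftB = W , disjointSolutions (suc zero) W (λ i j e → oddV i j (oddEnd e)) (λ i j e → evenV i j (evenEnd e))
        (λ i j e → look-odd padM (_↑ˡ ℓ) digM i j (oddEnd e) (dig-M _ (leftB j)) (look-M j i))
        (λ i j e → look-even id (a ↑ʳ_) digN i j (evenEnd e) (dig-N _ (rightA i)) (look-N j i))
        (λ i j e → trans (side-odd i j _ (κ≤k (oddEnd e))) (cong not (rightA i)))
        (λ i j e → Adj-sym graph (h (evenV i j (evenEnd e))) (h (oddV i j (oddEnd e))) (edge-adj i j e))
        (λ i j e i′ j′ e′ eq₁ eq₀ → same-edge i j e i′ j′ e′ eq₀ eq₁)
        where open Unknowns oddInner evenInner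

      -- Sides alternate along paths of odd length 2k+1, so the side of a single bⱼ fixes that of
      -- every aᵢ, and then that of every other bⱼ.
      solutions : Fin s → Fin t → ∃[ σ ] ∃[ W ] DisjointSolutions f t (sys σ) A W
      solutions i₀ j₀ with isLeft (h (branchB j₀)) in eq
      ... | false = zero , solutions-A⊆M leftA (λ j → trans (side-B i₀ j) (cong not (leftA i₀)))
        where
        leftA : ∀ i → isLeft (h (branchA i)) ≡ true
        leftA i = Bool.not-injective (trans (sym (side-B i j₀)) eq)
      ... | true = suc zero , solutions-A⊆N rightA (λ j → trans (side-B i₀ j) (cong not (rightA i₀)))
        where
        rightA : ∀ i → isLeft (h (branchA i)) ≡ false
        rightA i = Bool.not-injective (trans (sym (side-B i j₀)) eq)

  restrict-solutions : ∀ {q} (f : (Fin w → Fin q) → Fin c → Fin q) {t t₀} (t₀≤t : t₀ ℕ.≤ t) {σ A W} →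
    DisjointSolutions f t (sys σ) A W → DisjointSolutions f t₀ (sys σ) A (λ j → W (inject≤ j t₀≤t))
  restrict-solutions f t₀≤t sols = record
    { solves = λ j → solves (inject≤ j t₀≤t)
    ; disjoint = λ j e j′ e′ ne → disjoint (inject≤ j t₀≤t) e (inject≤ j′ t₀≤t) e′ λ { (eq , eq′) → ne (Fin.inject≤-injective t₀≤t t₀≤t j j′ eq , eq′) }
    }
    where open DisjointSolutions sols

  sparse-graph : 1 ℕ.≤ s → 1 ℕ.≤ k → n ℕ.≤ m ℕ.* c →
    ∃[ t₀ ] ∃[ q₀ ] (∀ t → t₀ ℕ.≤ t → ∀ q → q₀ ℕ.≤ q →
      Σ (BipGraph (q ℕ.^ a) (q ℕ.^ ℓ)) λ G → KstSubdivFree s t (2 ℕ.* k) G × q ℕ.^ a ℕ.* q ℕ.^ u ℕ.≤ edges G)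
  sparse-graph 1≤s 1≤k n≤ =
    let t₀ , q₀ , family = few-disjoint-solutions sys (combine i₀ zero) n≤ in
    -- The successors guarantee a vertex bⱼ whose side can be inspected and a digit to serve as
    -- filler.
    suc t₀ , suc q₀ , λ t t₀<t q q₀<q →
      let f , f-cong , none = family q (ℕ.<⇒≤ q₀<q) in
      graph f f-cong ,
      (λ { (h , h-inj , h-adj) →
        let open Embedded f f-cong (fromℕ< (ℕ.≤-trans (s≤s z≤n) q₀<q)) 1≤k h h-inj h-adj
            σ , W , sols = solutions i₀ (fromℕ< (ℕ.≤-trans (s≤s z≤n) t₀<t))
        in none σ A _ (restrict-solutions f (ℕ.<⇒≤ t₀<t) {σ} sols) }) ,
      edges≥ f f-cong
    where
    i₀ : Fin s
    i₀ = fromℕ< 1≤s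

-- The exponents

open import Data.Nat using (ℕ; suc; _+_; _*_; _^_; _≤_; _∸_)
open import Data.Product using (_×_; Σ; ∃-syntax)
open import Data.Rational using (ℚ; 1ℚ) renaming (_≤_ to _≤ℚ_; _*_ to _*ℚ_)
open import Data.Integer as ℤ using (+_; ∣_∣)
import Data.Integer.Properties as ℤ
open import Data.Rational using (toℚᵘ) renaming (_/_ to _/ℚ_)
import Data.Rational.Properties as ℚ
open import Data.Rational.Unnormalised as ℚᵘ using (mkℚᵘ; *≡*; *≤*)
import Data.Rational.Unnormalised.Properties as ℚᵘ

-- From rationals to natural numbers

toℚᵘ-/1 : ∀ z → toℚᵘ (z /ℚ 1) ℚᵘ.≃ mkℚᵘ z 0
toℚᵘ-/1 z = ℚ.toℚᵘ-fromℚᵘ (mkℚᵘ z 0)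

-- In the unnormalised rationals the equation is one between integers with denominator 1; absolute
-- values then make the quotient a natural number.
ℕ→ℚ-multiple : ∀ x d → IsIntQuot (ℕ→ℚ x) d → ∃[ y ] x ≡ y * d
ℕ→ℚ-multiple x d (z , eq) = ∣ z ∣ , trans (cong ∣_∣ eq′) (ℤ.abs-* z (+ d))
  where
  eqᵘ : mkℚᵘ (+ x) 0 ℚᵘ.≃ mkℚᵘ z 0 ℚᵘ.* mkℚᵘ (+ d) 0
  eqᵘ = ℚᵘ.≃-trans (ℚᵘ.≃-sym (toℚᵘ-/1 (+ x))) (ℚᵘ.≃-trans (ℚᵘ.≃-reflexive (cong toℚᵘ eq))
    (ℚᵘ.≃-trans (ℚ.toℚᵘ-homo-* (z /ℚ 1) (+ d /ℚ 1)) (ℚᵘ.*-cong (toℚᵘ-/1 z) (toℚᵘ-/1 (+ d)))))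
  eq′ : + x ≡ z ℤ.* + d
  eq′ with eqᵘ
  ... | *≡* e = trans (sym (ℤ.*-identityʳ (+ x))) (trans e (ℤ.*-identityʳ (z ℤ.* + d)))

ℕ→ℚ-cancel-≤ : ∀ x y → ℕ→ℚ x ≤ℚ ℕ→ℚ y → x ≤ y
ℕ→ℚ-cancel-≤ x y le with ℚᵘ.≤-respˡ-≃ (toℚᵘ-/1 (+ x)) (ℚᵘ.≤-respʳ-≃ (toℚᵘ-/1 (+ y)) (ℚ.toℚᵘ-mono-≤ le))
... | *≤* e = ℤ.drop‿+≤+ (subst₂ ℤ._≤_ (ℤ.*-identityʳ (+ x)) (ℤ.*-identityʳ (+ y)) e)

αℓ≤ℓ : ∀ {α} a ℓ → α ≤ℚ 1ℚ → ℕ→ℚ a ≡ α *ℚ ℕ→ℚ ℓ → a ≤ ℓ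
αℓ≤ℓ {α} a ℓ α≤1 eq = ℕ→ℚ-cancel-≤ a ℓ (subst₂ _≤ℚ_ (sym eq) (ℚ.*-identityˡ (ℕ→ℚ ℓ))
  (ℚ.*-monoʳ-≤-nonNeg (ℕ→ℚ ℓ) {{ℚ.normalize-nonNeg ℓ 1}} α≤1))

-- The choice of c and u

module Exponents (k s a′ b : ℕ) where

  -- The sides are a = a′N and ℓ = (a′+b)N, and `suc s` is the number of vertices aᵢ. Then `c` is
  -- the solution of the equation between the numbers of unknowns and equations, and `u` is ℓ - c
  -- expanded so that no subtraction occurs.
  P N c u : ℕ
  P = k * suc s
  N = suc (2 * k) * suc s
  c = P * a′ + (P + 1) * (a′ + b)
  u = s * a′ + (P + s) * b

  N≡ : N ≡ suc s + (P + P)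
  N≡ = lem k (suc s)
    where
    lem : ∀ k s → (1 + 2 * k) * s ≡ s + (k * s + k * s)
    lem = ℕ.solve-∀

  ℓ≡c+u : (a′ + b) * N ≡ c + u
  ℓ≡c+u = trans (cong ((a′ + b) *_) N≡) (lem P s a′ b)
    where
    lem : ∀ P s a b → (a + b) * (1 + s + (P + P)) ≡ (P * a + (P + 1) * (a + b)) + (s * a + (P + s) * b)
    lem = ℕ.solve-∀

  unknowns≡ : (c + u) + suc s * (k * (a′ * N + (c + u))) ≡ suc s * (suc k + k) * c
  unknowns≡ = begin
    (c + u) + suc s * (k * (a′ * N + (c + u)))            ≡⟨ cong (λ ℓ → ℓ + suc s * (k * (a′ * N + ℓ))) ℓ≡c+u ⟨
    (a′ + b) * N + suc s * (k * (a′ * N + (a′ + b) * N))  ≡⟨ lem₁ k (suc s) a′ b N ⟩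
    N * (P * a′ + (P + 1) * (a′ + b))                     ≡⟨ cong (_* c) (lem₂ k (suc s)) ⟩
    suc s * (suc k + k) * c                               ∎
    where
    open ≡-Reasoning
    lem₁ : ∀ k s a b N → (a + b) * N + s * (k * (a * N + (a + b) * N)) ≡ N * (k * s * a + (k * s + 1) * (a + b))
    lem₁ = ℕ.solve-∀
    lem₂ : ∀ k s → (1 + 2 * k) * s ≡ s * (1 + k + k)
    lem₂ = ℕ.solve-∀

  -- Raising to the power `N` turns the exponents 1 - k/(2k+1) and 1 - k/(2k+1) - 1/((2k+1)s) into
  -- (k+1)s and (k+1)s - 1, with `suc s` for s. The right-hand side is the exponent of q in the
  -- `N`-th power of q^(a+u).
  exponent≡ : a′ * N * ((k + 1) * suc s) + (c + u) * ((k + 1) * suc s ∸ 1) ≡ (a′ * N + u) * N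
  exponent≡ = begin
    a′ * N * ((k + 1) * suc s) + (c + u) * ((k + 1) * suc s ∸ 1) ≡⟨ cong₂ (λ x ℓ → a′ * N * x + ℓ * (x ∸ 1)) [k+1]s≡ (sym ℓ≡c+u) ⟩
    a′ * N * suc (s + P) + (a′ + b) * N * (s + P)                ≡⟨ lem₁ a′ b N s P ⟩
    (a′ * (suc s + (P + P)) + u) * N                             ≡⟨ cong (λ x → (a′ * x + u) * N) N≡ ⟨
    (a′ * N + u) * N                                             ∎
    where
    open ≡-Reasoning
    [k+1]s≡ : (k + 1) * suc s ≡ suc (s + P)
    [k+1]s≡ = cong (_* suc s) (ℕ.+-comm k 1)
    lem₁ : ∀ a b N s P → a * N * (1 + (s + P)) + (a + b) * N * (s + P) ≡ (a * (1 + s + (P + P)) + (s * a + (P + s) * b)) * N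
    lem₁ = ℕ.solve-∀

dense-free-graphs : ∀ k s a c u {ℓ} M M′ N → ℓ ≡ c + u → a ≤ ℓ → 1 ≤ s → 1 ≤ k →
  ℓ + s * (k * (a + ℓ)) ≡ s * (suc k + k) * c → a * M + ℓ * M′ ≡ (a + u) * N →
  ∃[ t₀ ] ∃[ q₀ ] (∀ t → t₀ ≤ t → ∀ q → q₀ ≤ q →
    Σ (BipGraph (q ^ a) (q ^ ℓ)) λ G → KstSubdivFree s t (2 * k) G × (q ^ a) ^ M * (q ^ ℓ) ^ M′ ≤ (2 * edges G) ^ N)
dense-free-graphs k s a c u {ℓ} M M′ N refl a≤ℓ 1≤s 1≤k unknowns exponents =
  let t₀ , q₀ , family = Construction.sparse-graph k s a c u a≤ℓ 1≤s 1≤k (ℕ.≤-reflexive unknowns) in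
  t₀ , q₀ , λ t t₀≤t q q₀≤q → let G , free , many = family t t₀≤t q q₀≤q in G , free , dense q (edges G) many
  where
  dense : ∀ q e → q ^ a * q ^ u ≤ e → (q ^ a) ^ M * (q ^ ℓ) ^ M′ ≤ (2 * e) ^ N
  dense q e many = begin
    (q ^ a) ^ M * (q ^ ℓ) ^ M′       ≡⟨ cong₂ _*_ (ℕ.^-*-assoc q a M) (ℕ.^-*-assoc q ℓ M′) ⟩
    q ^ (a * M) * q ^ (ℓ * M′)       ≡⟨ ℕ.^-distribˡ-+-* q (a * M) (ℓ * M′) ⟨
    q ^ (a * M + ℓ * M′)             ≡⟨ cong (q ^_) exponents ⟩
    q ^ ((a + u) * N)                ≡⟨ ℕ.^-*-assoc q (a + u) N ⟨
    (q ^ (a + u)) ^ N                ≡⟨ cong (_^ N) (ℕ.^-distribˡ-+-* q a u) ⟩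
    (q ^ a * q ^ u) ^ N              ≤⟨ ℕ.^-monoˡ-≤ N (ℕ.≤-trans many (ℕ.m≤n*m e 2)) ⟩
    (2 * e) ^ N                      ∎
    where open ℕ.≤-Reasoning

theorem5p9 : (k s : ℕ) (α : ℚ) → 2 ≤ k → 1 ≤ s →
    ℕ→ℚ (k * s + 1) ≤ℚ α *ℚ ℕ→ℚ (k * s + s) → α ≤ℚ 1ℚ →
    (ℓ : ℕ) → IsLeastEll k s α ℓ →
    (a : ℕ) → ℕ→ℚ a ≡ α *ℚ ℕ→ℚ ℓ →
    ∃[ t₀ ] ∃[ q₀ ] (∀ t → t₀ ≤ t → ∀ q → IsPrimePower q → q₀ ≤ q →
    Σ (BipGraph (q ^ a) (q ^ ℓ)) λ G →
    KstSubdivFree s t (2 * k) G ×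
    (q ^ a) ^ ((k + 1) * s) * (q ^ ℓ) ^ ((k + 1) * s ∸ 1)
    ≤ (2 * edges G) ^ (suc (2 * k) * s))
theorem5p9 k (suc s) α 2≤k 1≤s _ α≤1 ℓ (_ , (ℓ-int , αℓ-int) , _) a a≡αℓ =
  let N = suc (2 * k) * suc s
      ℓ′ , ℓ≡ = ℕ→ℚ-multiple ℓ N ℓ-int
      a′ , a≡ = ℕ→ℚ-multiple a N (subst (λ x → IsIntQuot x N) (sym a≡αℓ) αℓ-int)
      a≤ℓ = αℓ≤ℓ a ℓ α≤1 a≡αℓ
      -- α ≤ 1 gives a ≤ ℓ; writing ℓ/N as a′ + b makes `c` and `u` natural numbers by their very
      -- form.
      b , a′+b≡ℓ′ = ℕ.m≤n⇒∃[o]m+o≡n (ℕ.*-cancelʳ-≤ a′ ℓ′ N (subst₂ _≤_ a≡ ℓ≡ a≤ℓ))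
      open Exponents k s a′ b using (c; u; ℓ≡c+u; unknowns≡; exponent≡)
      ℓ≡′ = trans ℓ≡ (trans (cong (_* N) (sym a′+b≡ℓ′)) ℓ≡c+u)
      t₀ , q₀ , family = dense-free-graphs k (suc s) a c u ((k + 1) * suc s) ((k + 1) * suc s ∸ 1) N ℓ≡′ a≤ℓ 1≤s (ℕ.≤-trans (s≤s z≤n) 2≤k)
        (trans (cong₂ (λ a ℓ → ℓ + suc s * (k * (a + ℓ))) a≡ ℓ≡′) unknowns≡)
        (trans (cong₂ (λ a ℓ → a * ((k + 1) * suc s) + ℓ * ((k + 1) * suc s ∸ 1)) a≡ ℓ≡′)
          (trans exponent≡ (cong (λ a → (a + u) * N) (sym a≡))))
  in t₀ , q₀ , λ t t₀≤t q _ q₀≤q → family t t₀≤t q q₀≤q
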